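{- Let $n\geq 1$ and $k\geq 2$ be integers, and let $r$ be an integer with $1\le r\le$ the number of length-$n$ bordered words over $\Sigma_k$. The bordered word $w\in\Sigma_k^n$ with rank $r$ (i.e., the $r$-th word in the lexicographic listing of all length-$n$ bordered words over $\Sigma_k$) can be computed from $r,n,k$ in $O(n^4k\log k)$ time using $O(n)$ space, under the unit-cost RAM model.
   Context: $\Sigma_k=\{1,2,\ldots,k\}$ with $1<2<\cdots<k$, and $\Sigma_k^n$ is the set of length-$n$ words over $\Sigma_k$. Lexicographic order: for $x=x_1\cdots x_m$ and $y=y_1\cdots y_n$, $x<y$ if $x$ is a proper prefix of $y$, or if $x_i<y_i$ for the smallest $i$ with $x_i\neq y_i$. A border of a word $w$ is a word that is both a non-empty proper prefix and a non-empty proper suffix of $w$; $w$ is bordered if it has a border. Ranks start at $1$. Unit-cost RAM model: integer variables use constant space and integer arithmetic operations take constant time. -}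

module Defs where

open import Data.Bool using (if_then_else_)
open import Data.Fin as Fin using (Fin; toℕ)
import Data.Fin.Properties as Fin
open import Data.Integer as ℤ using (ℤ; +_; +[1+_]; -[1+_]; +0; 0ℤ)
open import Data.List using (List; []; _∷_; [_]; _++_; map; concat; filter; inits; allFin; length; lookup; head; drop; deduplicate)
open import Data.List.Membership.Propositional using (_∈_; lose; find)
open import Data.List.Membership.Propositional.Properties using (∈-map⁺; ∈-map⁻; ∈-concat⁺′; ∈-concat⁻′; ∈-allFin; ∈-filter⁺; ∈-filter⁻)
open import Data.List.Properties using (≡-dec)
open import Data.List.Relation.Binary.Lex.Strict using (Lex-<; this; next)
open import Data.List.Relation.Binary.Prefix.Heterogeneous using (Prefix; []; _∷_)
open import Data.List.Relation.Binary.Prefix.Heterogeneous.Properties using (prefix?)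
open import Data.List.Relation.Binary.Suffix.Heterogeneous using (Suffix)
open import Data.List.Relation.Binary.Suffix.Heterogeneous.Properties using (suffix?)
open import Data.List.Relation.Unary.All as All using (All; []; _∷_)
import Data.List.Relation.Unary.All.Properties as All
open import Data.List.Relation.Unary.AllPairs as AllPairs using (AllPairs; []; _∷_)
import Data.List.Relation.Unary.AllPairs.Properties as AllPairs
open import Data.List.Relation.Unary.Any using (here; there; any?)
open import Data.Maybe using (Maybe; just; nothing)
open import Data.Nat as ℕ using (ℕ; zero; suc)
open import Data.Product using (∃-syntax; _×_; _,_; proj₁; proj₂)
open import Function using (id)
open import Relation.Binary.PropositionalEquality using (_≡_; _≢_; refl; cong)
open import Relation.Nullary using (¬_; Dec; ⌊_⌋; ¬?)
open import Relation.Nullary.Decidable using (map′; _×-dec_)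

-- The element i of Fin k stands for the letter toℕ i + 1 of {1, …, k}.
Word : ℕ → Set
Word k = List (Fin k)

letter : ∀ {k} → Fin k → ℕ
letter i = suc (toℕ i)

_<ₗₑₓ_ : ∀ {k} → Word k → Word k → Set
_<ₗₑₓ_ = Lex-< _≡_ Fin._<_

record IsBorder {k} (u w : Word k) : Set where
  constructor mkBorder
  field
    nonEmpty : u ≢ []
    proper   : u ≢ w
    prefix   : Prefix _≡_ u w
    suffix   : Suffix _≡_ u w

Bordered : ∀ {k} → Word k → Set
Bordered w = ∃[ u ] IsBorder u w

record LexListing {k} (P : Word k → Set) : Set where
  field
    list     : List (Word k)
    sorted   : AllPairs _<ₗₑₓ_ list
    sound    : ∀ {w} → w ∈ list → P w
    complete : ∀ {w} → P w → w ∈ list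

isBorder? : ∀ {k} (u w : Word k) → Dec (IsBorder u w)
isBorder? u w =
  map′ (λ (a , b , c , d) → mkBorder a b c d)
       (λ (mkBorder a b c d) → a , b , c , d)
       (¬? (≡-dec Fin._≟_ u []) ×-dec ¬? (≡-dec Fin._≟_ u w)
         ×-dec prefix? Fin._≟_ u w ×-dec suffix? Fin._≟_ u w)

prefix⇒∈inits : ∀ {k} {u w : Word k} → Prefix _≡_ u w → u ∈ inits w
prefix⇒∈inits []                       = here refl
prefix⇒∈inits {w = x ∷ w} (refl ∷ u≤w) = there (∈-map⁺ (x ∷_) (prefix⇒∈inits u≤w))

bordered? : ∀ {k} (w : Word k) → Dec (Bordered w)
bordered? w =
  map′ (λ p → let (u , _ , b) = find p in u , b)
       (λ (u , b) → lose (prefix⇒∈inits (IsBorder.prefix b)) b)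
       (any? (λ u → isBorder? u w) (inits w))

words : ∀ k → ℕ → List (Word k)
words k zero    = [ [] ]
words k (suc n) = concat (map (λ a → map (a ∷_) (words k n)) (allFin k))

words-sorted : ∀ k n → AllPairs _<ₗₑₓ_ (words k n)
words-sorted k zero    = [] ∷ []
words-sorted k (suc n) = AllPairs.concat⁺
  (All.map⁺ (All.tabulate⁺ λ a →
    AllPairs.map⁺ (AllPairs.map (next refl) (words-sorted k n))))
  (AllPairs.map⁺ (AllPairs.tabulate⁺-< λ a<b →
    All.map⁺ (All.universal (λ _ →
      All.map⁺ (All.universal (λ _ → this a<b) (words k n))) (words k n))))

words-sound : ∀ k n {w} → w ∈ words k n → length w ≡ n
words-sound k zero    (here refl) = refl
words-sound k (suc n) w∈
  with ∈-concat⁻′ (map (λ a → map (a ∷_) (words k n)) (allFin k)) w∈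
... | vs , w∈vs , vs∈ with ∈-map⁻ (λ a → map (a ∷_) (words k n)) vs∈
... | a , _ , refl with ∈-map⁻ (a ∷_) w∈vs
... | v , v∈ , refl = cong suc (words-sound k n v∈)

words-complete : ∀ {k} (w : Word k) → w ∈ words k (length w)
words-complete []      = here refl
words-complete (a ∷ w) = ∈-concat⁺′ (∈-map⁺ (a ∷_) (words-complete w))
  (∈-map⁺ (λ b → map (b ∷_) (words _ (length w))) (∈-allFin a))

borderedListing : ∀ k n → LexListing {k} (λ w → length w ≡ n × Bordered w)
borderedListing k n = record
  { list     = filter bordered? (words k n)
  ; sorted   = AllPairs.filter⁺ bordered? (words-sorted k n)
  ; sound    = λ w∈ → let (w∈′ , b) = ∈-filter⁻ bordered? {xs = words k n} w∈
                      in words-sound k n w∈′ , b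
  ; complete = λ { {w} (refl , b) → ∈-filter⁺ bordered? (words-complete w) b }
  }

borderedWords : ∀ k n → List (Word k)
borderedWords k n = LexListing.list (borderedListing k n)

numBordered : ℕ → ℕ → ℕ
numBordered k n = length (borderedWords k n)

-- Ranks start at 1, positions in a list at 0.
HasBorderedRank : ∀ k n → Word k → ℕ → Set
HasBorderedRank k n w r =
  ∃[ i ] suc (toℕ i) ≡ r × lookup (borderedWords k n) i ≡ w

-- Unit-cost RAM: registers R[0], R[1], … each hold one (unbounded) integer;
-- every instruction costs one time unit.

data ArithOp : Set where
  add sub mul quo rem : ArithOp

-- Division by zero has no result and leaves the machine stuck.
⟦_⟧ : ArithOp → ℤ → ℤ → Maybe ℤ
⟦ add ⟧ x y          = just (x ℤ.+ y)
⟦ sub ⟧ x y          = just (x ℤ.- y)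
⟦ mul ⟧ x y          = just (x ℤ.* y)
⟦ quo ⟧ x +0         = nothing
⟦ quo ⟧ x y@(+[1+ _ ]) = just (x ℤ./ y)
⟦ quo ⟧ x y@(-[1+ _ ]) = just (x ℤ./ y)
⟦ rem ⟧ x +0         = nothing
⟦ rem ⟧ x y@(+[1+ _ ]) = just (+ (x ℤ.% y))
⟦ rem ⟧ x y@(-[1+ _ ]) = just (+ (x ℤ.% y))

data Instr : Set where
  const : (d : ℕ) (c : ℤ) → Instr                 -- R[d] ← c
  arith : (op : ArithOp) (d a b : ℕ) → Instr      -- R[d] ← R[a] op R[b]
  load  : (d a : ℕ) → Instr                       -- R[d] ← R[R[a]]
  store : (a b : ℕ) → Instr                       -- R[R[a]] ← R[b]
  jump  : (l : ℕ) → Instr                         -- goto l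
  jump≤ : (a b l : ℕ) → Instr                     -- if R[a] ≤ R[b] goto l
  halt  : Instr

Program : Set
Program = List Instr

Memory : Set
Memory = ℕ → ℤ

_[_↦_] : Memory → ℕ → ℤ → Memory
(m [ a ↦ v ]) b = if ⌊ a ℕ.≟ b ⌋ then v else m b

record Config : Set where
  constructor ⟨_,_⟩
  field
    pc  : ℕ
    mem : Memory

_at_ : Program → ℕ → Maybe Instr
P at i = head (drop i P)

-- P ⊢ c —[ as ]→ c′ : one instruction of P takes c to c′, accessing exactly
-- the registers in as.  Indirect access through a negative address is stuck.
data _⊢_—[_]→_ (P : Program) : Config → List ℕ → Config → Set where
  const : ∀ {i m d c} → P at i ≡ just (const d c) →
          P ⊢ ⟨ i , m ⟩ —[ d ∷ [] ]→ ⟨ suc i , m [ d ↦ c ] ⟩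
  arith : ∀ {i m op d a b v} → P at i ≡ just (arith op d a b) →
          ⟦ op ⟧ (m a) (m b) ≡ just v →
          P ⊢ ⟨ i , m ⟩ —[ d ∷ a ∷ b ∷ [] ]→ ⟨ suc i , m [ d ↦ v ] ⟩
  load  : ∀ {i m d a p} → P at i ≡ just (load d a) → m a ≡ + p →
          P ⊢ ⟨ i , m ⟩ —[ d ∷ a ∷ p ∷ [] ]→ ⟨ suc i , m [ d ↦ m p ] ⟩
  store : ∀ {i m a b p} → P at i ≡ just (store a b) → m a ≡ + p →
          P ⊢ ⟨ i , m ⟩ —[ a ∷ b ∷ p ∷ [] ]→ ⟨ suc i , m [ p ↦ m b ] ⟩
  jump  : ∀ {i m l} → P at i ≡ just (jump l) →
          P ⊢ ⟨ i , m ⟩ —[ [] ]→ ⟨ l , m ⟩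
  jump≤-yes : ∀ {i m a b l} → P at i ≡ just (jump≤ a b l) → m a ℤ.≤ m b →
          P ⊢ ⟨ i , m ⟩ —[ a ∷ b ∷ [] ]→ ⟨ l , m ⟩
  jump≤-no  : ∀ {i m a b l} → P at i ≡ just (jump≤ a b l) → ¬ (m a ℤ.≤ m b) →
          P ⊢ ⟨ i , m ⟩ —[ a ∷ b ∷ [] ]→ ⟨ suc i , m ⟩

data HaltingRun (P : Program) : Config → Memory → Set where
  stop : ∀ {i m} → P at i ≡ just halt → HaltingRun P ⟨ i , m ⟩ m
  _then_ : ∀ {c c′ as m} → P ⊢ c —[ as ]→ c′ → HaltingRun P c′ m → HaltingRun P c m

infixr 5 _then_

time : ∀ {P c m} → HaltingRun P c m → ℕ
time (stop _)   = 1
time (_ then ρ) = suc (time ρ)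

accessed : ∀ {P c m} → HaltingRun P c m → List ℕ
accessed (stop _)              = []
accessed (_then_ {as = as} _ ρ) = as ++ accessed ρ

-- The number of distinct registers accessed during the run.
space : ∀ {P c m} → HaltingRun P c m → ℕ
space ρ = length (deduplicate ℕ._≟_ (accessed ρ))

-- Arguments are passed in R[0], R[1], R[2]; all other registers start at 0.
input : ℕ → ℕ → ℕ → Memory
input x y z 0 = + x
input x y z 1 = + y
input x y z 2 = + z
input x y z _ = 0ℤ

-- A word is returned as a block of consecutive registers, one letter each,
-- whose starting address is left in R[0].
Outputs : ∀ {k} → Memory → Word k → Set
Outputs m w = ∃[ p ] m 0 ≡ + p ×
  (∀ (i : Fin (length w)) → m (p ℕ.+ toℕ i) ≡ + letter (lookup w i))

{-# OPTIONS --safe #-}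
module Submission where

-- A word of length n is identified with its base-k value, so that x / k^(n-l) and x mod k^l
-- are its prefix and suffix of length l, and the lexicographic order becomes the order on ℕ.
-- Every bordered word is u t u for a unique unbordered u, its shortest border, whose length is
-- at most half of that of the word.  Hence the number of bordered words of length L that are at
-- most the length-L prefix of a given z is a sum over l ≤ L/2 of terms that depend only on the
-- number of unbordered words of length l below the length-l prefix of z and on whether that
-- prefix is unbordered.  Tabulating both quantities for L = 1, …, n takes O(n²) steps and O(n)
-- registers.  The wanted word is then found digit by digit, with at most 1 + n k such counts.

open import Defs
open import Data.Bool as Bool using (true; false; if_then_else_)
open import Data.Empty using (⊥; ⊥-elim)
open import Data.Fin using (Fin; toℕ; fromℕ<)
open import Data.Fin.Properties using (fromℕ<-injective; injective⇒≤; toℕ<n; toℕ-fromℕ<; toℕ-injective)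
open import Data.Integer as ℤ using (+_; +≤+)
open import Data.Integer.DivMod using (div-pos-is-/ℕ)
import Data.Integer.Properties as ℤ
open import Data.List using (List; []; _∷_; _++_; length; lookup; map; concat; filter; tabulate; take; drop)
open import Data.List.Membership.Propositional.Properties using (∈-lookup)
open import Data.List.Properties using (++-identityʳ; length-++; take++drop≡id; length-take; length-drop)
open import Data.List.Relation.Binary.Pointwise using (Pointwise-≡⇒≡; ≡⇒Pointwise-≡)
open import Data.List.Relation.Binary.Prefix.Heterogeneous as Prefix using (Prefix)
open import Data.List.Relation.Binary.Suffix.Heterogeneous as Suffix using (Suffix)
open import Data.List.Relation.Unary.All as All using (All; []; _∷_)
import Data.List.Relation.Unary.All.Properties as All
open import Data.List.Relation.Unary.AllPairs using ([]; _∷_)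
open import Data.List.Relation.Unary.Unique.DecPropositional.Properties using (deduplicate-!)
open import Data.List.Relation.Unary.Unique.Propositional using (Unique)
open import Data.Maybe using (just)
open import Data.Nat
open import Data.Nat.Divisibility using (_∣_; divides-refl; ∣-trans; n∣m*n; m∣m*n)
open import Data.Nat.DivMod
open import Data.Nat.Induction using (<-rec)
open import Data.Nat.Logarithm using (⌊log₂_⌋; ⌊log₂⌋-mono-≤)
open import Data.Nat.Properties
open import Data.Nat.Tactic.RingSolver using (solve-∀)
open import Data.Product using (∃-syntax; Σ-syntax; _×_; _,_; proj₁; proj₂)
open import Function using (_∘_; _$_; id)
open import Relation.Binary.Definitions using (tri<; tri≈; tri>)
open import Relation.Binary.PropositionalEquality
open import Relation.Nullary using (¬_; Dec; yes; no; contradiction)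
open import Relation.Nullary.Decidable using (_×-dec_)
open import Relation.Unary using (Decidable)

-- The program never looks for a border. For each prefix `Z` it counts the bordered words below `Z`
-- and those up to `Z`; complements give the unbordered ones, and the difference of these two counts
-- tells whether `Z` is unbordered. Obtaining the second count by applying the first to `Z + 1`
-- would fail: the increment may carry into another short prefix, for which nothing is tabulated.
-- Hence both counts use the prefixes of `Z` itself and differ only in an offset `δ`. One pass fills
-- the table because a shortest border has at most half the length, so row `L` reads only earlier
-- rows.

-- Finite sums and indicators

∑ : ℕ → (ℕ → ℕ) → ℕ
∑ zero    f = 0
∑ (suc n) f = ∑ n f + f n

∑-cong : ∀ n {f g} → (∀ i → i < n → f i ≡ g i) → ∑ n f ≡ ∑ n g
∑-cong zero    eq = refl
∑-cong (suc n) eq = cong₂ _+_ (∑-cong n (λ i i<n → eq i (m≤n⇒m≤1+n i<n))) (eq n ≤-refl)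

∑-zero : ∀ n {f} → (∀ i → i < n → f i ≡ 0) → ∑ n f ≡ 0
∑-zero zero    eq = refl
∑-zero (suc n) eq = cong₂ _+_ (∑-zero n (λ i i<n → eq i (m≤n⇒m≤1+n i<n))) (eq n ≤-refl)

∑-only : ∀ n {f} j → j < n → (∀ i → i < n → i ≢ j → f i ≡ 0) → ∑ n f ≡ f j
∑-only (suc n) {f} j j<1+n eq with n ≟ j
... | yes refl = cong (_+ f n) (∑-zero n (λ i i<n → eq i (m≤n⇒m≤1+n i<n) (<⇒≢ i<n)))
... | no n≢j   = trans (cong₂ _+_
    (∑-only n j (≤∧≢⇒< (≤-pred j<1+n) (n≢j ∘ sym)) (λ i i<n → eq i (m≤n⇒m≤1+n i<n)))
    (eq n ≤-refl n≢j))
  (+-identityʳ (f j))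

∑-front : ∀ n f → ∑ (suc n) f ≡ f 0 + ∑ n (f ∘ suc)
∑-front zero    f = sym (+-identityʳ (f 0))
∑-front (suc n) f = trans (cong (_+ f (suc n)) (∑-front n f)) (+-assoc (f 0) _ _)

∑-+ : ∀ m n f → ∑ (m + n) f ≡ ∑ m f + ∑ n (λ i → f (m + i))
∑-+ m zero    f = trans (cong (λ x → ∑ x f) (+-identityʳ m)) (sym (+-identityʳ _))
∑-+ m (suc n) f rewrite +-suc m n = trans (cong (_+ f (m + n)) (∑-+ m n f)) (+-assoc (∑ m f) _ _)

∑-block : ∀ m n f → ∑ (m * n) f ≡ ∑ m (λ i → ∑ n (λ j → f (i * n + j)))
∑-block zero    n f = refl
∑-block (suc m) n f = begin
  ∑ (n + m * n) f                              ≡⟨ cong (λ x → ∑ x f) (+-comm n (m * n)) ⟩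
  ∑ (m * n + n) f                              ≡⟨ ∑-+ (m * n) n f ⟩
  ∑ (m * n) f + ∑ n (λ j → f (m * n + j))      ≡⟨ cong (_+ ∑ n (λ j → f (m * n + j))) (∑-block m n f) ⟩
  _                                            ∎
  where open ≡-Reasoning

∑-distrib-+ : ∀ n f g → ∑ n (λ i → f i + g i) ≡ ∑ n f + ∑ n g
∑-distrib-+ zero    f g = refl
∑-distrib-+ (suc n) f g rewrite ∑-distrib-+ n f g = lemma (∑ n f) (∑ n g) (f n) (g n)
  where
  lemma : ∀ a b c d → a + b + (c + d) ≡ a + c + (b + d)
  lemma = solve-∀

∑-*ˡ : ∀ n c f → ∑ n (λ i → c * f i) ≡ c * ∑ n f
∑-*ˡ zero    c f = sym (*-zeroʳ c)
∑-*ˡ (suc n) c f = trans (cong (_+ c * f n) (∑-*ˡ n c f)) (sym (*-distribˡ-+ c (∑ n f) (f n)))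

∑-*ʳ : ∀ n c f → ∑ n (λ i → f i * c) ≡ ∑ n f * c
∑-*ʳ n c f = trans (∑-cong n (λ i _ → *-comm (f i) c)) (trans (∑-*ˡ n c f) (*-comm c (∑ n f)))

∑-swap : ∀ m n (f : ℕ → ℕ → ℕ) → ∑ m (λ i → ∑ n (f i)) ≡ ∑ n (λ j → ∑ m (λ i → f i j))
∑-swap zero    n f = sym (∑-zero n (λ _ _ → refl))
∑-swap (suc m) n f = trans (cong (_+ ∑ n (f m)) (∑-swap m n f))
  (sym (∑-distrib-+ n (λ j → ∑ m (λ i → f i j)) (f m)))

∑-const-1 : ∀ n {f} → (∀ i → f i ≡ 1) → ∑ n f ≡ n
∑-const-1 zero    eq = refl
∑-const-1 (suc n) eq = trans (cong₂ _+_ (∑-const-1 n eq) (eq n)) (+-comm n 1)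

∑-mono-≤ : ∀ f {m n} → m ≤ n → ∑ m f ≤ ∑ n f
∑-mono-≤ f {m} m≤n with m≤n⇒∃[o]m+o≡n m≤n
... | j , refl = subst (∑ m f ≤_) (sym (∑-+ m j f)) (m≤m+n _ _)

𝟙 : ∀ {p} {P : Set p} → Dec P → ℕ
𝟙 (yes _) = 1
𝟙 (no  _) = 0

𝟙-yes : ∀ {p} {P : Set p} (d : Dec P) → P → 𝟙 d ≡ 1
𝟙-yes (yes _) _ = refl
𝟙-yes (no ¬p) p = contradiction p ¬p

𝟙-no : ∀ {p} {P : Set p} (d : Dec P) → ¬ P → 𝟙 d ≡ 0
𝟙-no (yes p) ¬p = contradiction p ¬p
𝟙-no (no _)  _  = refl

𝟙-cong : ∀ {p q} {P : Set p} {Q : Set q} (d : Dec P) (e : Dec Q) → (P → Q) → (Q → P) → 𝟙 d ≡ 𝟙 e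
𝟙-cong (yes p) e f g = sym (𝟙-yes e (f p))
𝟙-cong (no ¬p) e f g = sym (𝟙-no e (¬p ∘ g))

𝟙+[1∸𝟙] : ∀ {p} {P : Set p} (d : Dec P) → 𝟙 d + (1 ∸ 𝟙 d) ≡ 1
𝟙+[1∸𝟙] (yes _) = refl
𝟙+[1∸𝟙] (no _)  = refl

-- Division and the counting of residues

[q*d+s]/d≡q : ∀ q {s} d .{{_ : NonZero d}} → s < d → (q * d + s) / d ≡ q
[q*d+s]/d≡q q {s} d s<d = begin
  (q * d + s) / d     ≡⟨ +-distrib-/-∣ˡ s (divides-refl q) ⟩
  q * d / d + s / d   ≡⟨ cong₂ _+_ (m*n/n≡m q d) (m<n⇒m/n≡0 s<d) ⟩
  q + 0               ≡⟨ +-identityʳ q ⟩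
  q                   ∎
  where open ≡-Reasoning

[q*d+s]%d≡s : ∀ q {s} d .{{_ : NonZero d}} → s < d → (q * d + s) % d ≡ s
[q*d+s]%d≡s q {s} d s<d = trans (%-remove-+ˡ s (divides-refl q)) (m<n⇒m%n≡m s<d)

m≡[m/n]*n+m%n : ∀ m n .{{_ : NonZero n}} → m ≡ m / n * n + m % n
m≡[m/n]*n+m%n m n = trans (m≡m%n+[m/n]*n m n) (+-comm (m % n) _)

-- Adding `c` moves the residue `u` to `d ∸ 1`, so `(y + c) / d` increases at exactly those `y` that
-- have residue `u`.
∑-residue : ∀ d .{{_ : NonZero d}} u c → u + suc c ≡ d →
            ∀ y → ∑ y (λ t → 𝟙 (t % d ≟ u)) ≡ (y + c) / d
∑-residue d u c refl zero    = sym (m<n⇒m/n≡0 (m≤n+m (suc c) u))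
∑-residue d u c refl (suc y) = trans (cong (_+ 𝟙 (y % d ≟ u)) (∑-residue d u c refl y))
  (step (y / d) (y % d) (m%n<n y d) (m≡[m/n]*n+m%n y d))
  where
  open ≡-Reasoning
  step : ∀ q s → s < d → y ≡ q * d + s → (y + c) / d + 𝟙 (s ≟ u) ≡ suc (y + c) / d
  step q s s<d y≡ rewrite y≡ with <-cmp s u
  ... | tri< s<u s≢u _ = begin
    (q * d + s + c) / d + 𝟙 (s ≟ u)   ≡⟨ cong₂ _+_ (cong (_/ d) (+-assoc (q * d) s c)) (𝟙-no (s ≟ u) s≢u) ⟩
    (q * d + (s + c)) / d + 0         ≡⟨ +-identityʳ _ ⟩
    (q * d + (s + c)) / d             ≡⟨ [q*d+s]/d≡q q d (+-mono-<-≤ s<u (n≤1+n c)) ⟩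
    q                                 ≡⟨ [q*d+s]/d≡q q d (+-mono-<-≤ s<u (≤-refl {suc c})) ⟨
    (q * d + (s + suc c)) / d         ≡⟨ cong (_/ d) (lemma (q * d) s c) ⟩
    suc (q * d + s + c) / d           ∎
    where
    lemma : ∀ a b c → a + (b + suc c) ≡ suc (a + b + c)
    lemma = solve-∀
  ... | tri≈ _ refl _ = begin
    (q * d + s + c) / d + 𝟙 (s ≟ s)   ≡⟨ cong₂ _+_ (cong (_/ d) (+-assoc (q * d) s c)) (𝟙-yes (s ≟ s) refl) ⟩
    (q * d + (s + c)) / d + 1         ≡⟨ cong (_+ 1) ([q*d+s]/d≡q q d (+-monoʳ-< s (n<1+n c))) ⟩
    q + 1                             ≡⟨ +-comm q 1 ⟩
    suc q                             ≡⟨ m*n/n≡m (suc q) d ⟨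
    suc q * d / d                     ≡⟨ cong (_/ d) (lemma q s c) ⟩
    suc (q * d + s + c) / d           ∎
    where
    lemma : ∀ q s c → suc q * (s + suc c) ≡ suc (q * (s + suc c) + s + c)
    lemma = solve-∀
  -- With `s = suc (u + e)` the numerator is `suc q * d + e`: the hit in the current block is
  -- already counted.
  ... | tri> _ s≢u u<s with m≤n⇒∃[o]m+o≡n u<s
  ... | e , refl = begin
    (q * d + s′ + c) / d + 𝟙 (s′ ≟ u)   ≡⟨ cong₂ _+_ (cong (_/ d) (lemma q u e c)) (𝟙-no (s′ ≟ u) s≢u) ⟩
    (suc q * d + e) / d + 0             ≡⟨ +-identityʳ _ ⟩
    (suc q * d + e) / d                 ≡⟨ [q*d+s]/d≡q (suc q) d (<-trans (n<1+n e) 1+e<d) ⟩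
    suc q                               ≡⟨ [q*d+s]/d≡q (suc q) d 1+e<d ⟨
    (suc q * d + suc e) / d             ≡⟨ cong (_/ d) (lemma′ q u e c) ⟩
    suc (q * d + s′ + c) / d            ∎
    where
    s′ = suc (u + e)
    1+e<d : suc e < d
    1+e<d = ≤-<-trans (s≤s (m≤n+m e u)) s<d
    lemma : ∀ q u e c → q * (u + suc c) + suc (u + e) + c ≡ suc q * (u + suc c) + e
    lemma = solve-∀
    lemma′ : ∀ q u e c → suc q * (u + suc c) + suc e ≡ suc (q * (u + suc c) + suc (u + e) + c)
    lemma′ = solve-∀

-- Borders of words coded as numbers

module Borders (k : ℕ) .{{_ : NonZero k}} where

  infixl 7 _/^_ _%^_

  -- The quotient drops the last n letters of a word, the remainder keeps them.
  _/^_ _%^_ : ℕ → ℕ → ℕ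
  m /^ n = (m / k ^ n) {{m^n≢0 k n}}
  m %^ n = (m % k ^ n) {{m^n≢0 k n}}

  k^a*k^b≢0 : ∀ a b → NonZero (k ^ a * k ^ b)
  k^a*k^b≢0 a b = m*n≢0 (k ^ a) (k ^ b) {{m^n≢0 k a}} {{m^n≢0 k b}}

  /^-/^ : ∀ m a b → m /^ a /^ b ≡ m /^ (a + b)
  /^-/^ m a b = trans
    (m/n/o≡m/[n*o] m (k ^ a) (k ^ b) {{m^n≢0 k a}} {{m^n≢0 k b}} {{k^a*k^b≢0 a b}})
    (/-congʳ {{k^a*k^b≢0 a b}} {{m^n≢0 k (a + b)}} (sym (^-distribˡ-+-* k a b)))

  %^-%^ : ∀ m a b → m %^ (a + b) %^ a ≡ m %^ a
  %^-%^ m a b = m∣n⇒o%n%m≡o%m (k ^ a) (k ^ (a + b)) m {{m^n≢0 k a}} {{m^n≢0 k (a + b)}}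
    (subst (k ^ a ∣_) (sym (^-distribˡ-+-* k a b)) (m∣m*n (k ^ b)))

  %^-/^ : ∀ m a b → m %^ (a + b) /^ b ≡ m /^ b %^ a
  %^-/^ m a b = trans
    (cong (_/^ b) (%-congʳ {{m^n≢0 k (a + b)}} {{k^a*k^b≢0 a b}} (^-distribˡ-+-* k a b)))
    (m%[n*o]/o≡m/o%n m (k ^ a) (k ^ b) {{m^n≢0 k a}} {{m^n≢0 k b}} {{k^a*k^b≢0 a b}})

  -- The length-(l + d) word with base-k value w has a border of length l.
  Border : ℕ → ℕ → ℕ → Set
  Border l d w = w /^ d ≡ w %^ l

  HasBorder : ℕ → ℕ → Set
  HasBorder L w = ∃[ l ] l < L × (0 < l × Border l (L ∸ l) w)

  hasBorder? : ∀ L w → Dec (HasBorder L w)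
  hasBorder? L w = anyUpTo? (λ l → (0 <? l) ×-dec (w /^ (L ∸ l) ≟ w %^ l)) L

  mkHasBorder : ∀ {l d w} → 0 < l → 0 < d → Border l d w → HasBorder (l + d) w
  mkHasBorder {l} {d} {w} 0<l 0<d b =
    l , m<m+n l 0<d , 0<l , subst (λ x → Border l x w) (sym (m+n∸m≡n l d)) b

  bd unb : ℕ → ℕ → ℕ
  bd  L w = 𝟙 (hasBorder? L w)
  unb L w = 1 ∸ bd L w

  bd+unb : ∀ L w → bd L w + unb L w ≡ 1
  bd+unb L w = 𝟙+[1∸𝟙] (hasBorder? L w)

  unb-no : ∀ {L w} → ¬ HasBorder L w → unb L w ≡ 1
  unb-no {L} {w} ¬b = cong (1 ∸_) (𝟙-no (hasBorder? L w) ¬b)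

  border-of-border : ∀ a b d {w} → Border (a + b) d w → Border a b (w /^ d) → Border a (b + d) w
  border-of-border a b d {w} out inn = begin
    w /^ (b + d)         ≡⟨ cong (λ x → w /^ x) (+-comm b d) ⟩
    w /^ (d + b)         ≡⟨ /^-/^ w d b ⟨
    w /^ d /^ b       ≡⟨ inn ⟩
    w /^ d %^ a       ≡⟨ cong (_%^ a) out ⟩
    w %^ (a + b) %^ a ≡⟨ %^-%^ w a b ⟩
    w %^ a               ∎
    where open ≡-Reasoning

  -- Both borders are prefixes and suffixes of `w`, so the shorter is a prefix and a suffix of the
  -- longer.
  border-restrict : ∀ a b d {w} → Border (a + b) d w → Border a (b + d) w → Border a b (w /^ d)
  border-restrict a b d {w} out b₁ = begin
    w /^ d /^ b       ≡⟨ /^-/^ w d b ⟩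
    w /^ (d + b)         ≡⟨ cong (λ x → w /^ x) (+-comm d b) ⟩
    w /^ (b + d)         ≡⟨ b₁ ⟩
    w %^ a               ≡⟨ %^-%^ w a b ⟨
    w %^ (a + b) %^ a ≡⟨ cong (_%^ a) out ⟨
    w /^ d %^ a       ∎
    where open ≡-Reasoning

  -- The overlap of an occurrence of the border as prefix with one as suffix is a border again.
  border-overlap : ∀ e d {w} → Border (e + d) d w → Border e (d + d) w
  border-overlap e d {w} b = border-of-border e d d b (begin
    w /^ d /^ d       ≡⟨ cong (_/^ d) b ⟩
    w %^ (e + d) /^ d ≡⟨ %^-/^ w e d ⟩
    w /^ d %^ e       ∎)
    where open ≡-Reasoning

  ShortBorder : ℕ → ℕ → Set
  ShortBorder L w = ∃[ l ] ∃[ d ] l + d ≡ L × 0 < l × l ≤ d × Border l d w × ¬ HasBorder l (w /^ d)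

  -- Descent on the length: a border longer than half the word is replaced by its self-overlap, a
  -- bordered one by its own border.
  shortBorder : ∀ w l d → 0 < l → 0 < d → Border l d w → ShortBorder (l + d) w
  shortBorder w = <-rec (λ l → ∀ d → 0 < l → 0 < d → Border l d w → ShortBorder (l + d) w) go
    where
    go : ∀ l → (∀ {l′} → l′ < l → ∀ d → 0 < l′ → 0 < d → Border l′ d w → ShortBorder (l′ + d) w) →
         ∀ d → 0 < l → 0 < d → Border l d w → ShortBorder (l + d) w
    go l rec d 0<l 0<d b with l ≤? d
    -- Since `d < l` strictly, the overlap has positive length `suc e = l ∸ d`.
    ... | no l≰d with m≤n⇒∃[o]m+o≡n (≰⇒> l≰d)
    ... | e , refl =
      subst (λ x → ShortBorder x w) (lemma e d)
        (rec (s≤s (m<n+m e 0<d)) (d + d) z<s (≤-trans 0<d (m≤m+n d d))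
          (border-overlap (suc e) d (subst (λ x → Border x d w) (lemma′ e d) b)))
      where
      lemma : ∀ e d → suc e + (d + d) ≡ suc (d + e) + d
      lemma = solve-∀
      lemma′ : ∀ e d → suc (d + e) ≡ suc e + d
      lemma′ = solve-∀
    go l rec d 0<l 0<d b | yes l≤d with hasBorder? l (w /^ d)
    ... | no ¬b = l , d , refl , 0<l , l≤d , b , ¬b
    ... | yes (l′ , l′<l , 0<l′ , b′) with m≤n⇒∃[o]m+o≡n (<⇒≤ l′<l)
    ... | j , refl =
      subst (λ x → ShortBorder x w) (sym (+-assoc l′ j d))
        (rec l′<l (j + d) 0<l′ (≤-trans 0<d (m≤n+m d j))
          (border-of-border l′ j d b (subst (λ x → Border l′ x (w /^ d)) (m+n∸m≡n l′ j) b′)))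

  -- A border is the shortest one if and only if it is itself unbordered.
  shortest : ℕ → ℕ → ℕ → ℕ
  shortest l d w = unb l (w /^ d) * 𝟙 (w %^ l ≟ w /^ d)

  shortest-yes : ∀ l d w → Border l d w → ¬ HasBorder l (w /^ d) → shortest l d w ≡ 1
  shortest-yes l d w b ¬b = cong₂ _*_ (unb-no ¬b) (𝟙-yes (w %^ l ≟ w /^ d) (sym b))

  shortest-no : ∀ l d w → (Border l d w → ¬ HasBorder l (w /^ d) → ⊥) → shortest l d w ≡ 0
  shortest-no l d w no-short with hasBorder? l (w /^ d) | w %^ l ≟ w /^ d
  ... | yes _ | _      = refl
  ... | no _  | no _   = refl
  ... | no ¬b | yes eq = ⊥-elim (no-short (sym eq) ¬b)

  -- This gives uniqueness of the unbordered border: of two borders of different lengths, the longer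
  -- has the shorter as a border.
  shorter-border : ∀ {L w} l l′ → l < l′ → l′ ≤ L → 0 < l →
    Border l (L ∸ l) w → Border l′ (L ∸ l′) w → HasBorder l′ (w /^ (L ∸ l′))
  shorter-border {L} {w} l l′ l<l′ l′≤L 0<l b b′ with m≤n⇒∃[o]m+o≡n (<⇒≤ l<l′) | m≤n⇒∃[o]m+o≡n l′≤L
  ... | j , refl | d , refl = mkHasBorder 0<l (+-cancelˡ-< l 0 j (subst (_< l + j) (sym (+-identityʳ l)) l<l′))
    (subst (λ x → Border l j (w /^ x)) (sym d≡) (border-restrict l j d
      (subst (λ x → Border (l + j) x w) d≡ b′)
      (subst (λ x → Border l x w) (trans (cong (_∸ l) (+-assoc l j d)) (m+n∸m≡n l (j + d))) b)))
    where
    d≡ : l + j + d ∸ (l + j) ≡ d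
    d≡ = m+n∸m≡n (l + j) d

  -- The hypotheses say `h = ⌊L/2⌋`. Exactly one summand is 1 if the word is bordered, namely that
  -- of the shortest border, which lies within this range.
  bd-∑ : ∀ L h w → h + h ≤ L → L < suc h + suc h →
         bd L w ≡ ∑ h (λ i → shortest (suc i) (L ∸ suc i) w)
  bd-∑ L h w 2h≤L L<2h+2 with hasBorder? L w
  ... | no ¬b = sym (∑-zero h (λ i i<h → shortest-no (suc i) (L ∸ suc i) w
    (λ b _ → ¬b (suc i , i<L i<h , z<s , b))))
    where
    i<L : ∀ {i} → i < h → suc i < L
    i<L i<h = ≤-trans (+-mono-≤ (≤-trans (s≤s z≤n) i<h) i<h) 2h≤L
  ... | yes (l₀ , l₀<L , 0<l₀ , b₀)
    with subst (λ x → ShortBorder x w) (m+[n∸m]≡n (<⇒≤ l₀<L))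
           (shortBorder w l₀ (L ∸ l₀) 0<l₀ (m<n⇒0<n∸m l₀<L) b₀)
  ... | suc j , d , refl , 0<l , l≤d , b , ¬b = sym (trans
    (∑-only h j j<h (λ i i<h i≢j → shortest-no (suc i) (L ∸ suc i) w (other i i<h i≢j)))
    (shortest-yes (suc j) (L ∸ suc j) w bⱼ ¬bⱼ))
    where
    d≡ : suc j + d ∸ suc j ≡ d
    d≡ = m+n∸m≡n (suc j) d
    bⱼ : Border (suc j) (L ∸ suc j) w
    bⱼ = subst (λ x → Border (suc j) x w) (sym d≡) b
    ¬bⱼ : ¬ HasBorder (suc j) (w /^ (L ∸ suc j))
    ¬bⱼ = ¬b ∘ subst (λ x → HasBorder (suc j) (w /^ x)) d≡
    -- Otherwise `l ≤ d` would make `suc j + d`, which is `L`, at least `suc h + suc h`.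
    j<h : j < h
    j<h = ≰⇒> (λ h≤j → <⇒≱ L<2h+2 (+-mono-≤ (s≤s h≤j) (≤-trans (s≤s h≤j) l≤d)))
    other : ∀ i → i < h → i ≢ j → Border (suc i) (L ∸ suc i) w → ¬ HasBorder (suc i) (w /^ (L ∸ suc i)) → ⊥
    other i i<h i≢j bᵢ ¬bᵢ with <-cmp i j
    ... | tri< i<j _ _ = ¬bⱼ (shorter-border (suc i) (suc j) (s≤s i<j) (m≤m+n (suc j) d) z<s bᵢ bⱼ)
    ... | tri≈ _ i≡j _ = i≢j i≡j
    ... | tri> _ _ j<i = ¬bᵢ (shorter-border (suc j) (suc i) (s≤s j<i)
      (≤-trans (≤-trans i<h (m≤m+n h h)) 2h≤L) z<s bⱼ bᵢ)

  -- Counting the bordered words up to a bound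

  -- With Z = u · k^d + y the first summand counts the words u′ t u′ with u′ < u, the second
  -- those with u′ = u.
  term : (δ Z l d : ℕ) → ℕ
  term δ Z l d = ∑ (Z /^ d) (unb l) * k ^ (d ∸ l)
    + unb l (Z /^ d) * ((Z %^ d + δ + (k ^ l ∸ suc (Z /^ d))) / k ^ l) {{m^n≢0 k l}}

  -- The words of the row share the prefix `q` of length `l`, and by `l ≤ d` their suffix of length
  -- `l` depends on `t` alone. What remains is to count residues modulo `k ^ l`.
  ∑-shortest-row : ∀ l d q y → l ≤ d → y ≤ k ^ d → q < k ^ l →
    ∑ y (λ t → shortest l d (q * k ^ d + t)) ≡ unb l q * ((y + (k ^ l ∸ suc q)) / k ^ l) {{m^n≢0 k l}}
  ∑-shortest-row l d q y l≤d y≤k^d q<k^l = begin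
    ∑ y (λ t → shortest l d (q * k ^ d + t))    ≡⟨ ∑-cong y (λ t t<y → cell t (≤-trans t<y y≤k^d)) ⟩
    ∑ y (λ t → unb l q * 𝟙 (t %^ l ≟ q))        ≡⟨ ∑-*ˡ y (unb l q) _ ⟩
    unb l q * ∑ y (λ t → 𝟙 (t %^ l ≟ q))
      ≡⟨ cong (unb l q *_) (∑-residue (k ^ l) {{m^n≢0 k l}} q (k ^ l ∸ suc q)
           (trans (+-suc q _) (m+[n∸m]≡n q<k^l)) y) ⟩
    _                                           ∎
    where
    open ≡-Reasoning
    cell : ∀ t → t < k ^ d → shortest l d (q * k ^ d + t) ≡ unb l q * 𝟙 (t %^ l ≟ q)
    cell t t<k^d = cong₂ (λ a b → unb l a * 𝟙 (b ≟ a))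
      ([q*d+s]/d≡q q (k ^ d) {{m^n≢0 k d}} t<k^d)
      (%-remove-+ˡ t {{m^n≢0 k l}} (∣-trans k^l∣k^d (n∣m*n q)))
      where
      k^l∣k^d : k ^ l ∣ k ^ d
      k^l∣k^d with m≤n⇒∃[o]m+o≡n l≤d
      ... | e , refl = subst (k ^ l ∣_) (sym (^-distribˡ-+-* k l e)) (m∣m*n (k ^ e))

  -- `δ = 0` counts below `Z`, `δ = 1` up to `Z`. Rows of smaller prefixes are complete; the row of
  -- `q` is cut off after `y + δ` words, and `δ ≤ 1` keeps the cut within that row.
  ∑-shortest : ∀ δ Z l d → δ ≤ 1 → l ≤ d → Z < k ^ (l + d) → ∑ (Z + δ) (shortest l d) ≡ term δ Z l d
  ∑-shortest δ Z l d δ≤1 l≤d Z< = begin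
    ∑ (Z + δ) f
      ≡⟨ cong (λ x → ∑ (x + δ) f) (m≡[m/n]*n+m%n Z M) ⟩
    ∑ (q * M + y + δ) f
      ≡⟨ cong (λ x → ∑ x f) (+-assoc (q * M) y δ) ⟩
    ∑ (q * M + (y + δ)) f
      ≡⟨ ∑-+ (q * M) (y + δ) f ⟩
    ∑ (q * M) f + ∑ (y + δ) (λ t → f (q * M + t))
      ≡⟨ cong₂ _+_ (∑-block q M f) (∑-shortest-row l d q (y + δ) l≤d y+δ≤M q<K) ⟩
    ∑ q (λ u → ∑ M (λ t → f (u * M + t))) + _
      ≡⟨ cong (_+ unb l q * ((y + δ + (K ∸ suc q)) / K)) (trans (∑-cong q row) (∑-*ʳ q (k ^ (d ∸ l)) (unb l))) ⟩
    term δ Z l d ∎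
    where
    open ≡-Reasoning
    f = shortest l d
    K = k ^ l
    M = k ^ d
    instance
      K≢0 = m^n≢0 k l
      M≢0 = m^n≢0 k d
    q = Z / M
    y = Z % M
    y+δ≤M : y + δ ≤ M
    y+δ≤M = ≤-trans (+-monoʳ-≤ y δ≤1) (subst (_≤ M) (+-comm 1 y) (m%n<n Z M))
    q<K : q < K
    q<K = m<n*o⇒m/o<n (subst (Z <_) (^-distribˡ-+-* k l d) Z<)
    -- In a complete row `M` is a multiple of `K`, and the added `K ∸ suc u < K` causes no carry.
    row : ∀ u → u < q → ∑ M (λ t → f (u * M + t)) ≡ unb l u * k ^ (d ∸ l)
    row u u<q = trans (∑-shortest-row l d u M l≤d ≤-refl u<K) (cong (unb l u *_) (begin
      (M + (K ∸ suc u)) / K              ≡⟨ cong (λ x → (x + (K ∸ suc u)) / K) M≡ ⟩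
      (k ^ (d ∸ l) * K + (K ∸ suc u)) / K ≡⟨ [q*d+s]/d≡q (k ^ (d ∸ l)) K (∸-monoʳ-< z<s u<K) ⟩
      k ^ (d ∸ l)                        ∎))
      where
      u<K = <-trans u<q q<K
      M≡ : M ≡ k ^ (d ∸ l) * K
      M≡ = trans (cong (k ^_) (sym (m∸n+n≡m l≤d))) (^-distribˡ-+-* k (d ∸ l) l)

  ∑-bd : ∀ δ Z L h → δ ≤ 1 → h + h ≤ L → L < suc h + suc h → Z < k ^ L →
         ∑ (Z + δ) (bd L) ≡ ∑ h (λ i → term δ Z (suc i) (L ∸ suc i))
  ∑-bd δ Z L h δ≤1 2h≤L L<2h+2 Z< = begin
    ∑ (Z + δ) (bd L)
      ≡⟨ ∑-cong (Z + δ) (λ w _ → bd-∑ L h w 2h≤L L<2h+2) ⟩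
    ∑ (Z + δ) (λ w → ∑ h (λ i → shortest (suc i) (L ∸ suc i) w))
      ≡⟨ ∑-swap (Z + δ) h _ ⟩
    ∑ h (λ i → ∑ (Z + δ) (shortest (suc i) (L ∸ suc i)))
      ≡⟨ ∑-cong h (λ i i<h → ∑-shortest δ Z (suc i) (L ∸ suc i) δ≤1
           (m+n≤o⇒m≤o∸n (suc i) (≤-trans (+-mono-≤ i<h i<h) 2h≤L))
           (subst (λ x → Z < k ^ x) (sym (m+[n∸m]≡n (≤-trans (≤-trans i<h (m≤m+n h h)) 2h≤L))) Z<)) ⟩
    ∑ h (λ i → term δ Z (suc i) (L ∸ suc i)) ∎
    where open ≡-Reasoning

  ∑-bd+∑-unb : ∀ X L → ∑ X (bd L) + ∑ X (unb L) ≡ X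
  ∑-bd+∑-unb X L = trans (sym (∑-distrib-+ X (bd L) (unb L))) (∑-const-1 X (bd+unb L))

-- Space from a bound on the addresses

unique-lookup-injective : ∀ {A : Set} {xs : List A} → Unique xs →
  ∀ {i j} → lookup xs i ≡ lookup xs j → i ≡ j
unique-lookup-injective (_ ∷ _)   {Fin.zero}  {Fin.zero}  _  = refl
unique-lookup-injective (x∉ ∷ _)  {Fin.zero}  {Fin.suc j} eq = contradiction eq (All.lookup x∉ (∈-lookup j))
unique-lookup-injective (x∉ ∷ _)  {Fin.suc i} {Fin.zero}  eq = contradiction (sym eq) (All.lookup x∉ (∈-lookup i))
unique-lookup-injective (_ ∷ uxs) {Fin.suc i} {Fin.suc j} eq = cong Fin.suc (unique-lookup-injective uxs eq)

length-unique-< : ∀ {B xs} → Unique xs → All (_< B) xs → length xs ≤ B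
length-unique-< {B} {xs} uxs xs<B = injective⇒≤ {f = λ i → fromℕ< (bound i)}
  (λ {i} {j} → unique-lookup-injective uxs ∘ fromℕ<-injective _ _ (bound i) (bound j))
  where
  bound : ∀ i → lookup xs i < B
  bound i = All.lookup xs<B (∈-lookup i)

space-≤ : ∀ {P c m B} (ρ : HaltingRun P c m) → All (_< B) (accessed ρ) → space ρ ≤ B
space-≤ ρ ρ<B = length-unique-< (deduplicate-! _≟_ (accessed ρ)) (All.deduplicate⁺ _≟_ ρ<B)

-- Memories and rules for halting runs

-- No computation below leaves the natural numbers, so memories are modelled by ℕ → ℕ.
State : Set
State = ℕ → ℕ

-- The test `_≡ᵇ_` reduces when a fixed register is compared with `24 + i`, even for a variable `i`;
-- facts about fixed registers therefore survive table writes definitionally.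
_[_≔_] : State → ℕ → ℕ → State
(σ [ a ≔ v ]) b = if a ≡ᵇ b then v else σ b

≔-same : ∀ σ a v → (σ [ a ≔ v ]) a ≡ v
≔-same σ a v with a ≡ᵇ a | ≡⇒≡ᵇ a a refl
... | true | _ = refl

≔-other : ∀ σ {a b} v → a ≢ b → (σ [ a ≔ v ]) b ≡ σ b
≔-other σ {a} {b} v a≢b with a ≡ᵇ b | ≡ᵇ⇒≡ a b
... | true  | f = contradiction (f _) a≢b
... | false | _ = refl

_≈_ : Memory → State → Set
m ≈ σ = ∀ a → m a ≡ + σ a

≈-update : ∀ {m σ} a {v x} → v ≡ + x → m ≈ σ → (m [ a ↦ v ]) ≈ (σ [ a ≔ x ])
≈-update {m} {σ} a {v} {x} v≡x m≈σ b with a ≟ b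
... | yes refl = trans v≡x (cong +_ (sym (≔-same σ a x)))
... | no a≢b   = trans (m≈σ b) (cong +_ (sym (≔-other σ x a≢b)))

module Execution (P : Program) (B : ℕ) (Q : State → Set) where

  -- Quantifying over all `m ≈ σ` avoids any appeal to equality of memories as functions. The rules
  -- derive this for an instruction from the rest of the run, so correctness proofs follow the
  -- program text and loops take a continuation.
  Halts : ℕ → ℕ → State → Set
  Halts t i σ = ∀ m → m ≈ σ → ∃[ m′ ] (∃[ σ′ ] m′ ≈ σ′ × Q σ′) ×
    (Σ[ ρ ∈ HaltingRun P ⟨ i , m ⟩ m′ ] (time ρ ≤ t × All (_< B) (accessed ρ)))

  weaken : ∀ {t t′ i σ} → t ≤ t′ → Halts t i σ → Halts t′ i σ
  weaken t≤t′ h m m≈σ with h m m≈σ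
  ... | m′ , q , ρ , ρ≤t , ρ<B = m′ , q , ρ , ≤-trans ρ≤t t≤t′ , ρ<B

  step : ∀ {t i σ j σ′} as → All (_< B) as →
         (∀ m → m ≈ σ → ∃[ m₁ ] m₁ ≈ σ′ × P ⊢ ⟨ i , m ⟩ —[ as ]→ ⟨ j , m₁ ⟩) →
         Halts t j σ′ → Halts (suc t) i σ
  step as as<B f h m m≈σ with f m m≈σ
  ... | m₁ , m₁≈σ′ , s with h m₁ m₁≈σ′
  ... | m′ , q , ρ , ρ≤t , ρ<B = m′ , q , s then ρ , s≤s ρ≤t , All.++⁺ as<B ρ<B

  halt-step : ∀ {i σ} → P at i ≡ just halt → Q σ → Halts 1 i σ
  halt-step {σ = σ} at≡ q m m≈σ = m , (σ , m≈σ , q) , stop at≡ , ≤-refl , []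

  module Steps (F : ℕ) (F≤B : F ≤ B) where

    -- For a literal register this reduces to the unit type, so the bounds in the rules are found by
    -- unification.
    Fixed : ℕ → Set
    Fixed a = Bool.T (a <ᵇ F)

    <B : ∀ a → Fixed a → a < B
    <B a a<F = ≤-trans (<ᵇ⇒< a F a<F) F≤B

    const-step : ∀ {t i σ d c} {d< : Fixed d} → P at i ≡ just (const d (+ c)) →
      Halts t (suc i) (σ [ d ≔ c ]) → Halts (suc t) i σ
    const-step {d = d} {d< = d<} at≡ = step (d ∷ []) (<B d d< ∷ [])
      λ m m≈σ → _ , ≈-update d refl m≈σ , const at≡

    arith-step : ∀ {t i σ op d a b v} {d< : Fixed d} {a< : Fixed a} {b< : Fixed b} →
      P at i ≡ just (arith op d a b) → ⟦ op ⟧ (+ σ a) (+ σ b) ≡ just (+ v) →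
      Halts t (suc i) (σ [ d ≔ v ]) → Halts (suc t) i σ
    arith-step {op = op} {d} {a} {b} {d< = d<} {a<} {b<} at≡ eq =
      step (d ∷ a ∷ b ∷ []) (<B d d< ∷ <B a a< ∷ <B b b< ∷ [])
        λ m m≈σ → _ , ≈-update d refl m≈σ , arith at≡ (trans (cong₂ ⟦ op ⟧ (m≈σ a) (m≈σ b)) eq)

    -- The stored value v is explicit: if it were inferred, every step would copy the whole
    -- preceding state into it, and terms would grow exponentially along the program.
    add-step : ∀ {t i σ d a b x y} v {d< : Fixed d} {a< : Fixed a} {b< : Fixed b} →
      P at i ≡ just (arith add d a b) → σ a ≡ x → σ b ≡ y → x + y ≡ v →
      Halts t (suc i) (σ [ d ≔ v ]) → Halts (suc t) i σ
    add-step _ {d< = d<} {a<} {b<} at≡ refl refl refl = arith-step {d< = d<} {a<} {b<} at≡ refl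

    mul-step : ∀ {t i σ d a b x y} v {d< : Fixed d} {a< : Fixed a} {b< : Fixed b} →
      P at i ≡ just (arith mul d a b) → σ a ≡ x → σ b ≡ y → x * y ≡ v →
      Halts t (suc i) (σ [ d ≔ v ]) → Halts (suc t) i σ
    mul-step {σ = σ} {a = a} {b} _ {d< = d<} {a<} {b<} at≡ refl refl refl =
      arith-step {d< = d<} {a<} {b<} at≡ (cong just (sym (ℤ.pos-* (σ a) (σ b))))

    -- The form `x ≡ y + v`, unlike `x ∸ y ≡ v`, ensures that the integer difference is not
    -- negative.
    sub-step : ∀ {t i σ d a b x y} v {d< : Fixed d} {a< : Fixed a} {b< : Fixed b} →
      P at i ≡ just (arith sub d a b) → σ a ≡ x → σ b ≡ y → x ≡ y + v →
      Halts t (suc i) (σ [ d ≔ v ]) → Halts (suc t) i σ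
    sub-step {σ = σ} {a = a} {b} v {d<} {a<} {b<} at≡ refl refl eq =
      arith-step {d< = d<} {a<} {b<} at≡ (cong just (begin
        + σ a ℤ.- + σ b        ≡⟨ ℤ.m-n≡m⊖n (σ a) (σ b) ⟩
        σ a ℤ.⊖ σ b            ≡⟨ cong (ℤ._⊖ σ b) eq ⟩
        (σ b + v) ℤ.⊖ σ b      ≡⟨ ℤ.⊖-≥ (m≤m+n (σ b) v) ⟩
        + (σ b + v ∸ σ b)      ≡⟨ cong +_ (m+n∸m≡n (σ b) v) ⟩
        + v                    ∎))
      where open ≡-Reasoning

    quo-step : ∀ {t i σ d a b x y} v {d< : Fixed d} {a< : Fixed a} {b< : Fixed b} →
      P at i ≡ just (arith quo d a b) → σ a ≡ x → σ b ≡ y → (y≢0 : NonZero y) → (x / y) {{y≢0}} ≡ v →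
      Halts t (suc i) (σ [ d ≔ v ]) → Halts (suc t) i σ
    quo-step {σ = σ} {a = a} {b} _ {d< = d<} {a<} {b<} at≡ refl refl y≢0 refl =
      arith-step {d< = d<} {a<} {b<} at≡ (quo≡ (σ a) (σ b) y≢0)
      where
      quo≡ : ∀ x y (y≢0 : NonZero y) → ⟦ quo ⟧ (+ x) (+ y) ≡ just (+ (x / y) {{y≢0}})
      quo≡ x (suc y) _ = cong just (div-pos-is-/ℕ (+ x) (suc y))

    rem-step : ∀ {t i σ d a b x y} v {d< : Fixed d} {a< : Fixed a} {b< : Fixed b} →
      P at i ≡ just (arith rem d a b) → σ a ≡ x → σ b ≡ y → (y≢0 : NonZero y) → (x % y) {{y≢0}} ≡ v →
      Halts t (suc i) (σ [ d ≔ v ]) → Halts (suc t) i σ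
    rem-step {σ = σ} {a = a} {b} _ {d< = d<} {a<} {b<} at≡ refl refl y≢0 refl =
      arith-step {d< = d<} {a<} {b<} at≡ (rem≡ (σ a) (σ b) y≢0)
      where
      rem≡ : ∀ x y (y≢0 : NonZero y) → ⟦ rem ⟧ (+ x) (+ y) ≡ just (+ (x % y) {{y≢0}})
      rem≡ x (suc y) _ = refl

    load-step : ∀ {t i σ d a} p v {d< : Fixed d} {a< : Fixed a} →
      P at i ≡ just (load d a) → σ a ≡ p → p < B → σ p ≡ v →
      Halts t (suc i) (σ [ d ≔ v ]) → Halts (suc t) i σ
    load-step {d = d} {a} p _ {d< = d<} {a<} at≡ refl p<B refl =
      step (d ∷ a ∷ p ∷ []) (<B d d< ∷ <B a a< ∷ p<B ∷ [])
      λ m m≈σ → _ , ≈-update d (m≈σ p) m≈σ , load at≡ (m≈σ a)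

    store-step : ∀ {t i σ a b} p v {a< : Fixed a} {b< : Fixed b} →
      P at i ≡ just (store a b) → σ a ≡ p → p < B → σ b ≡ v →
      Halts t (suc i) (σ [ p ≔ v ]) → Halts (suc t) i σ
    store-step {a = a} {b} p _ {a< = a<} {b<} at≡ refl p<B refl =
      step (a ∷ b ∷ p ∷ []) (<B a a< ∷ <B b b< ∷ p<B ∷ [])
      λ m m≈σ → _ , ≈-update p (m≈σ b) m≈σ , store at≡ (m≈σ a)

    jump-step : ∀ {t i σ l} → P at i ≡ just (jump l) → Halts t l σ → Halts (suc t) i σ
    jump-step at≡ = step [] [] λ m m≈σ → m , m≈σ , jump at≡

    jump≤-taken : ∀ {t i σ a b l x y} {a< : Fixed a} {b< : Fixed b} →
      P at i ≡ just (jump≤ a b l) → σ a ≡ x → σ b ≡ y → x ≤ y → Halts t l σ → Halts (suc t) i σ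
    jump≤-taken {a = a} {b} {a< = a<} {b<} at≡ refl refl x≤y = step (a ∷ b ∷ []) (<B a a< ∷ <B b b< ∷ [])
      λ m m≈σ → m , m≈σ , jump≤-yes at≡ (subst₂ ℤ._≤_ (sym (m≈σ a)) (sym (m≈σ b)) (+≤+ x≤y))

    jump≤-skipped : ∀ {t i σ a b l x y} {a< : Fixed a} {b< : Fixed b} →
      P at i ≡ just (jump≤ a b l) → σ a ≡ x → σ b ≡ y → y < x → Halts t (suc i) σ → Halts (suc t) i σ
    jump≤-skipped {a = a} {b} {a< = a<} {b<} at≡ refl refl y<x = step (a ∷ b ∷ []) (<B a a< ∷ <B b b< ∷ [])
      λ m m≈σ → m , m≈σ , jump≤-no at≡
        (λ le → <⇒≱ y<x (ℤ.drop‿+≤+ (subst₂ ℤ._≤_ (m≈σ a) (m≈σ b) le)))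

-- Register names and the program

#r #n #k #x #P #z #L #l #s₀ #s₁ #D #Z #K #M #u #y #a #e #t #q #1 #base #N #0 : ℕ
#r = 0
#n = 1
#k = 2
#x = 3
#P = 4
#z = 5
#L = 6
#l = 7
#s₀ = 8
#s₁ = 9
#D = 10
#Z = 11
#K = 12
#M = 13
#u = 14
#y = 15
#a = 16
#e = 17
#t = 18
#q = 19
#1 = 20
#base = 21
#N = 22
#0 = 23

-- The two table entries for length l are at addresses 24 + 2l and 25 + 2l; the output, from
-- address 24 on, overwrites them.  Numbers in the comments are addresses of jump targets.
program : Program
program =
    const #1 (+ 1)
  ∷ const #base (+ 24)
  ∷ const #N (+ 1)
  -- 3: N ← k ^ n
  ∷ jump≤ #n #L 7
  ∷ arith mul #N #N #k
  ∷ arith add #L #L #1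
  ∷ jump 3
  -- 7: x = 0, P ← k ^ n
  ∷ arith add #P #N #0
  -- 8: while P ≠ 0, count the bordered words ≤ z = x + P − 1
  ∷ jump≤ #P #0 63
  ∷ arith add #z #x #P
  ∷ arith sub #z #z #1
  ∷ const #L (+ 0)
  ∷ arith add #D #N #0
  -- 13: for L = 1, …, n, with D = k ^ (n − L) and Z the prefix of z of length L
  ∷ jump≤ #n #L 58
  ∷ arith add #L #L #1
  ∷ arith quo #D #D #k
  ∷ arith quo #Z #z #D
  ∷ arith quo #M #N #D
  ∷ const #K (+ 1)
  ∷ const #l (+ 0)
  ∷ const #s₀ (+ 0)
  ∷ const #s₁ (+ 0)
  -- 22: for l = 1, 2, … while l + l ≤ L
  ∷ arith add #l #l #1
  ∷ arith add #t #l #l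
  ∷ jump≤ #t #L 26
  ∷ jump 48
  -- 26: K = k ^ l, M = k ^ (L − l), Z = u · M + y
  ∷ arith mul #K #K #k
  ∷ arith quo #M #M #k
  ∷ arith quo #u #Z #M
  ∷ arith rem #y #Z #M
  ∷ arith add #t #t #base
  ∷ load #a #t
  ∷ arith add #t #t #1
  ∷ load #e #t
  ∷ arith quo #q #M #K
  ∷ arith mul #a #a #q
  ∷ arith add #y #y #K
  ∷ arith sub #y #y #u
  ∷ arith quo #q #y #K
  ∷ arith mul #q #q #e
  ∷ arith add #s₁ #s₁ #a
  ∷ arith add #s₁ #s₁ #q
  ∷ arith sub #y #y #1
  ∷ arith quo #q #y #K
  ∷ arith mul #q #q #e
  ∷ arith add #s₀ #s₀ #a
  ∷ arith add #s₀ #s₀ #q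
  ∷ jump 22
  -- 48: tabulate the number of unbordered words < Z and whether Z is unbordered
  ∷ arith add #t #L #L
  ∷ arith add #t #t #base
  ∷ arith sub #a #Z #s₀
  ∷ store #t #a
  ∷ arith add #t #t #1
  ∷ arith add #e #Z #1
  ∷ arith sub #e #e #s₁
  ∷ arith sub #e #e #a
  ∷ store #t #e
  ∷ jump 13
  -- 58: if fewer than r bordered words are ≤ z, then x ← x + P
  ∷ jump≤ #r #s₁ 61
  ∷ arith add #x #x #P
  ∷ jump 8
  -- 61: else P ← P / k
  ∷ arith quo #P #P #k
  ∷ jump 8
  -- 63: write the digits of x, the last one first
  ∷ arith add #l #n #0
  -- 64
  ∷ jump≤ #l #0 72
  ∷ arith sub #l #l #1
  ∷ arith rem #e #x #k
  ∷ arith add #e #e #1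
  ∷ arith quo #x #x #k
  ∷ arith add #t #l #base
  ∷ store #t #e
  ∷ jump 64
  -- 72
  ∷ arith add 0 #base #0
  ∷ halt
  ∷ []

-- Doubling and halving

m+m-injective : ∀ {m n} → m + m ≡ n + n → m ≡ n
m+m-injective {m} {n} eq = trans (n≡⌊n+n/2⌋ m) (trans (cong ⌊_/2⌋ eq) (sym (n≡⌊n+n/2⌋ n)))

1+m+m≢n+n : ∀ m n → suc (m + m) ≢ n + n
1+m+m≢n+n m n eq = even≢odd n m (trans (2*≡ n) (trans (sym eq) (cong suc (sym (2*≡ m)))))
  where
  2*≡ : ∀ m → 2 * m ≡ m + m
  2*≡ m = cong (λ x → m + x) (+-identityʳ m)

∃-half : ∀ L → ∃[ h ] h + h ≤ L × L < suc h + suc h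
∃-half zero          = 0 , z≤n , s≤s z≤n
∃-half (suc zero)    = 0 , z≤n , s≤s (s≤s z≤n)
∃-half (suc (suc L)) with ∃-half L
... | h , 2h≤L , L<2h+2 = suc h ,
  s≤s (subst (_≤ suc L) (sym (+-suc h h)) (s≤s 2h≤L)) ,
  s≤s (subst (suc L <_) (sym (+-suc (suc h) (suc h))) (s≤s L<2h+2))

-- Filling the table for one bound

module Correctness (n k r T : ℕ) {{k≢0 : NonZero k}} where

  open Borders k

  -- The highest address used is `25 + (n + n)`, in the last row of the table.
  B : ℕ
  B = 28 + (n + n)

  Output : State → Set
  Output σ = σ 0 ≡ 24 × (∀ i → i < n → σ (24 + i) ≡ suc (T /^ (n ∸ suc i) % k))

  open Execution program B Output
  open Execution.Steps program B Output 24 (m≤m+n 24 (4 + (n + n)))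

  Constants : State → Set
  Constants σ = σ #r ≡ r × σ #n ≡ n × σ #k ≡ k × σ #1 ≡ 1 × σ #base ≡ 24 × σ #N ≡ k ^ n × σ #0 ≡ 0

  k^[1+j]/k : ∀ j → k ^ suc j / k ≡ k ^ j
  k^[1+j]/k j = trans (cong (_/ k) (*-comm k (k ^ j))) (m*n/n≡m (k ^ j) k)

  k^a/k^b : ∀ {a b} → b ≤ a → k ^ a /^ b ≡ k ^ (a ∸ b)
  k^a/k^b {a} {b} b≤a = trans
    (cong (_/^ b) (trans (cong (k ^_) (sym (m∸n+n≡m b≤a))) (^-distribˡ-+-* k (a ∸ b) b)))
    (m*n/n≡m (k ^ (a ∸ b)) (k ^ b) {{m^n≢0 k b}})

  ∸-suc : ∀ {i L} → i < L → L ∸ i ≡ suc (L ∸ suc i)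
  ∸-suc {i} {L} i<L = +-∸-assoc 1 i<L

  module Count (x P z : ℕ) (z<k^n : z < k ^ n) where

    Frame : State → Set
    Frame σ = Constants σ × σ #x ≡ x × σ #P ≡ P × σ #z ≡ z

    Table : State → ℕ → Set
    Table σ L = ∀ l → 0 < l → l < L →
      σ (24 + (l + l)) ≡ ∑ (z /^ (n ∸ l)) (unb l) × σ (25 + (l + l)) ≡ unb l (z /^ (n ∸ l))

    prefix-< : ∀ {l} → l ≤ n → z /^ (n ∸ l) < k ^ l
    prefix-< {l} l≤n = m<n*o⇒m/o<n {{m^n≢0 k (n ∸ l)}}
      (subst (z <_) (trans (cong (k ^_) (sym (m+[n∸m]≡n l≤n))) (^-distribˡ-+-* k l (n ∸ l))) z<k^n)

    prefix-prefix : ∀ {l L} → l ≤ L → L ≤ n → z /^ (n ∸ L) /^ (L ∸ l) ≡ z /^ (n ∸ l)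
    prefix-prefix {l} {L} l≤L L≤n = trans (/^-/^ z (n ∸ L) (L ∸ l))
      (cong (z /^_) (trans (sym (+-∸-assoc (n ∸ L) l≤L)) (cong (_∸ l) (m∸n+n≡m L≤n))))

    module Inner (L h : ℕ) (L≤n : L ≤ n) (2h≤L : h + h ≤ L) (L<2h+2 : L < suc h + suc h) where

      Z : ℕ
      Z = z /^ (n ∸ L)

      Frame′ : State → Set
      Frame′ σ = Frame σ × Table σ L × σ #L ≡ L × σ #D ≡ k ^ (n ∸ L) × σ #Z ≡ Z

      S : ℕ → ℕ → ℕ
      S δ i = ∑ i (λ j → term δ Z (suc j) (L ∸ suc j))

      Inv : ℕ → State → Set
      Inv i σ = Frame′ σ × σ #K ≡ k ^ i × σ #M ≡ k ^ (L ∸ i) × σ #l ≡ i × σ #s₀ ≡ S 0 i × σ #s₁ ≡ S 1 i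

      module Body (i : ℕ) (i<h : i < h) where

        l d U y c A E : ℕ
        l = suc i
        d = L ∸ l
        U = Z /^ d
        y = Z %^ d
        c = k ^ l ∸ suc U
        A = ∑ U (unb l)
        E = unb l U

        2l≤L : l + l ≤ L
        2l≤L = ≤-trans (+-mono-≤ i<h i<h) 2h≤L

        i<L : i < L
        i<L = ≤-trans (m≤m+n l l) 2l≤L

        l≤d : l ≤ d
        l≤d = m+n≤o⇒m≤o∸n l 2l≤L

        l+l≤n+n : l + l ≤ n + n
        l+l≤n+n = ≤-trans 2l≤L (≤-trans L≤n (m≤m+n n n))

        U≡ : z /^ (n ∸ l) ≡ U
        U≡ = sym (prefix-prefix i<L L≤n)

        -- The program forms the numerator for `δ = 1`, which is `y + 1 + c`, as `y + k ^ l` minus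
        -- `U`; decrementing it then yields the one for `δ = 0`.
        y+k^l≡ : y + k ^ l ≡ U + (y + suc c)
        y+k^l≡ = trans (cong (λ v → y + v) (sym (m+[n∸m]≡n U<k^l))) (lemma y U c)
          where
          U<k^l : U < k ^ l
          U<k^l = subst (_< k ^ l) U≡ (prefix-< (≤-trans i<L L≤n))
          lemma : ∀ a b c → a + (suc b + c) ≡ b + (a + suc c)
          lemma = solve-∀

        body : ∀ {t} σ → Inv i σ → (∀ σ′ → Inv l σ′ → Halts t 22 σ′) → Halts (25 + t) 22 σ
        body σ (fr@(((_ , _ , σk , σ1 , σbase , _) , _) , table , σL , _ , σZ) ,
                σK , σM , σl , σs₀ , σs₁) cont =
          add-step l refl σl σ1 (+-comm i 1) $
          add-step (l + l) refl refl refl refl $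
          jump≤-taken refl refl σL 2l≤L $
          mul-step (k ^ l) refl σK σk (*-comm (k ^ i) k) $
          quo-step (k ^ d) refl σM σk k≢0 (trans (cong (λ j → k ^ j / k) (∸-suc i<L)) (k^[1+j]/k d)) $
          quo-step U refl σZ refl (m^n≢0 k d) refl $
          rem-step y refl σZ refl (m^n≢0 k d) refl $
          add-step (24 + (l + l)) refl refl σbase (+-comm (l + l) 24) $
          load-step (24 + (l + l)) A refl refl (+-mono-≤ (m≤m+n 25 3) l+l≤n+n)
            (trans (proj₁ entry) (cong (λ v → ∑ v (unb l)) U≡)) $
          add-step (25 + (l + l)) refl refl σ1 (+-comm (24 + (l + l)) 1) $
          load-step (25 + (l + l)) E refl refl (+-mono-≤ (m≤m+n 26 2) l+l≤n+n)
            (trans (proj₂ entry) (cong (unb l) U≡)) $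
          quo-step (k ^ (d ∸ l)) refl refl refl (m^n≢0 k l) (k^a/k^b l≤d) $
          mul-step (A * k ^ (d ∸ l)) refl refl refl refl $
          add-step (y + k ^ l) refl refl refl refl $
          sub-step (y + suc c) refl refl refl y+k^l≡ $
          quo-step ((y + 1 + c) /^ l) refl refl refl (m^n≢0 k l) (cong (_/^ l) (sym (+-assoc y 1 c))) $
          mul-step (E * ((y + 1 + c) /^ l)) refl refl refl (*-comm _ E) $
          add-step (S 1 i + A * k ^ (d ∸ l)) refl σs₁ refl refl $
          add-step (S 1 l) refl refl refl (+-assoc (S 1 i) _ _) $
          sub-step (y + c) refl refl σ1 (+-suc y c) $
          quo-step ((y + 0 + c) /^ l) refl refl refl (m^n≢0 k l) (cong (λ v → (v + c) /^ l) (sym (+-identityʳ y))) $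
          mul-step (E * ((y + 0 + c) /^ l)) refl refl refl (*-comm _ E) $
          add-step (S 0 i + A * k ^ (d ∸ l)) refl σs₀ refl refl $
          add-step (S 0 l) refl refl refl (+-assoc (S 0 i) _ _) $
          jump-step refl $
          cont _ (fr , refl , refl , refl , refl , refl)
          where
          -- From `l + l ≤ L` and `1 ≤ l` follows `l < L`, so the entry is already there.
          entry = table l z<s (≤-trans (+-monoˡ-≤ l (s≤s z≤n)) 2l≤L)

      inner : ∀ {t} m i σ → i + m ≡ h → Inv i σ →
        (∀ σ′ → Frame′ σ′ → σ′ #s₀ ≡ S 0 h → σ′ #s₁ ≡ S 1 h → Halts t 48 σ′) →
        Halts (m * 25 + (4 + t)) 22 σ
      inner zero i σ i≡h inv cont with trans (sym (+-identityʳ i)) i≡h | inv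
      ... | refl | fr@((( _ , _ , _ , σ1 , _) , _) , _ , σL , _) , _ , _ , σl , σs₀ , σs₁ =
        add-step (suc h) refl σl σ1 (+-comm h 1) $
        add-step (suc h + suc h) refl refl refl refl $
        jump≤-skipped refl refl σL L<2h+2 $
        jump-step refl $
        cont _ fr σs₀ σs₁
      inner (suc m) i σ i≡h inv cont = Body.body i (subst (i <_) i≡h (m<m+n i z<s)) σ inv
        λ σ′ inv′ → inner m (suc i) σ′ (trans (sym (+-suc i m)) i≡h) inv′ cont

    -- Older entries survive both writes: parity separates the two columns, injectivity of doubling
    -- the rows.
    Table-extend : ∀ σ L → Table σ L →
      Table ((σ [ 24 + (L + L) ≔ ∑ (z /^ (n ∸ L)) (unb L) ]) [ 25 + (L + L) ≔ unb L (z /^ (n ∸ L)) ]) (suc L)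
    Table-extend σ L table l 0<l l<1+L with l ≟ L
    ... | yes refl =
      trans (≔-other (σ [ 24 + (L + L) ≔ a ]) e (1+n≢n {24 + (L + L)})) (≔-same σ (24 + (L + L)) a) ,
      ≔-same (σ [ 24 + (L + L) ≔ a ]) (25 + (L + L)) e
      where
      a = ∑ (z /^ (n ∸ L)) (unb L)
      e = unb L (z /^ (n ∸ L))
    ... | no l≢L =
      trans (≔-other (σ [ 24 + (L + L) ≔ a ]) e (1+m+m≢n+n L l ∘ +-cancelˡ-≡ 24 _ _))
        (trans (≔-other σ a (l≢L ∘ sym ∘ m+m-injective ∘ +-cancelˡ-≡ 24 _ _)) (proj₁ old)) ,
      trans (≔-other (σ [ 24 + (L + L) ≔ a ]) e (l≢L ∘ sym ∘ m+m-injective ∘ +-cancelˡ-≡ 25 _ _))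
        (trans (≔-other σ a (1+m+m≢n+n l L ∘ sym ∘ +-cancelˡ-≡ 24 _ _)) (proj₂ old))
      where
      a = ∑ (z /^ (n ∸ L)) (unb L)
      e = unb L (z /^ (n ∸ L))
      old = table l 0<l (≤∧≢⇒< (≤-pred l<1+L) l≢L)

    Inv : ℕ → State → Set
    Inv L σ = Frame σ × Table σ (suc L) × σ #L ≡ L × σ #D ≡ k ^ (n ∸ L)

    module Row (L₀ : ℕ) (L≤n : suc L₀ ≤ n) where

      L h Z A E : ℕ
      L = suc L₀
      h = proj₁ (∃-half L)
      Z = z /^ (n ∸ L)
      A = ∑ Z (unb L)
      E = unb L Z

      2h≤L : h + h ≤ L
      2h≤L = proj₁ (proj₂ (∃-half L))

      L<2h+2 : L < suc h + suc h
      L<2h+2 = proj₂ (proj₂ (∃-half L))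

      open Inner L h L≤n 2h≤L L<2h+2 using (inner; S; Frame′)

      S₀≡ : Z ≡ S 0 h + A
      S₀≡ = trans (sym (∑-bd+∑-unb Z L)) (cong (_+ A)
        (trans (cong (λ v → ∑ v (bd L)) (sym (+-identityʳ Z)))
               (∑-bd 0 Z L h z≤n 2h≤L L<2h+2 (prefix-< L≤n))))

      S₁≡ : S 1 h ≡ ∑ (Z + 1) (bd L)
      S₁≡ = sym (∑-bd 1 Z L h ≤-refl 2h≤L L<2h+2 (prefix-< L≤n))

      fill : ∀ {t} σ → Frame′ σ → σ #s₀ ≡ S 0 h → σ #s₁ ≡ S 1 h →
        (∀ σ′ → Inv L σ′ → σ′ #s₁ ≡ ∑ (Z + 1) (bd L) → Halts t 13 σ′) → Halts (10 + t) 48 σ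
      fill σ (fr@((_ , _ , _ , σ1 , σbase , _) , _) , table , σL , σD , σZ) σs₀ σs₁ cont =
        add-step (L + L) refl σL σL refl $
        add-step (24 + (L + L)) refl refl σbase (+-comm (L + L) 24) $
        sub-step A refl σZ σs₀ S₀≡ $
        store-step (24 + (L + L)) A refl refl (+-mono-≤ (m≤m+n 25 3) L+L≤n+n) refl $
        add-step (25 + (L + L)) refl refl σ1 (+-comm (24 + (L + L)) 1) $
        add-step (Z + 1) refl σZ σ1 refl $
        sub-step (∑ (Z + 1) (unb L)) refl refl (trans σs₁ S₁≡) (sym (∑-bd+∑-unb (Z + 1) L)) $
        -- The sum up to `suc Z` unfolds to `A + E`, so the difference is the last summand.
        sub-step E refl refl refl (cong (λ v → ∑ v (unb L)) (+-comm Z 1)) $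
        store-step (25 + (L + L)) E refl refl (+-mono-≤ (m≤m+n 26 2) L+L≤n+n) refl $
        jump-step refl $
        cont _ (fr , Table-extend σ L table , σL , σD) (trans σs₁ S₁≡)
        where
        L+L≤n+n : L + L ≤ n + n
        L+L≤n+n = +-mono-≤ L≤n L≤n

      row : ∀ {t} σ → Inv L₀ σ →
        (∀ σ′ → Inv L σ′ → σ′ #s₁ ≡ ∑ (Z + 1) (bd L) → Halts t 13 σ′) → Halts (n * 25 + (23 + t)) 13 σ
      row {t} σ (fr@((_ , σn , σk , σ1 , _ , σN , σ0) , _ , _ , σz) , table , σL , σD) cont =
        weaken time≤ $
        jump≤-skipped refl σn σL L≤n $
        add-step L refl σL σ1 (+-comm L₀ 1) $
        quo-step (k ^ (n ∸ L)) refl σD σk k≢0 (trans (cong (λ j → k ^ j / k) (∸-suc L≤n)) (k^[1+j]/k (n ∸ L))) $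
        quo-step Z refl σz refl (m^n≢0 k (n ∸ L)) refl $
        quo-step (k ^ L) refl σN refl (m^n≢0 k (n ∸ L))
          (trans (k^a/k^b (m∸n≤m n L)) (cong (k ^_) (m∸[m∸n]≡n L≤n))) $
        const-step refl $
        const-step refl $
        const-step refl $
        const-step refl $
        inner h 0 _ refl ((fr , table , refl , refl , refl) , refl , refl , refl , refl , refl)
          λ σ′ fr′ σs₀ σs₁ → fill σ′ fr′ σs₀ σs₁ cont
        where
        -- The 23 is 9 steps of set-up, 4 to leave the inner loop and 10 to store the entries.
        time≤ : 9 + (h * 25 + (4 + (10 + t))) ≤ n * 25 + (23 + t)
        time≤ = begin
          9 + (h * 25 + (4 + (10 + t)))  ≡⟨ lemma (h * 25) t ⟩
          h * 25 + (23 + t)              ≤⟨ +-monoˡ-≤ (23 + t) (*-monoˡ-≤ 25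
                                             (≤-trans (≤-trans (m≤m+n h h) 2h≤L) L≤n)) ⟩
          n * 25 + (23 + t)              ∎
          where
          open ≤-Reasoning
          lemma : ∀ a t → 9 + (a + (4 + (10 + t))) ≡ a + (23 + t)
          lemma = solve-∀

    -- The claim on `#s₁` is guarded by `0 < L` because before the first row that register holds a
    -- leftover value; at the exit `L = n`, and `0 < n` releases it.
    rows : ∀ {t} m L σ → L + m ≡ n → Inv L σ → (0 < L → σ #s₁ ≡ ∑ (z /^ (n ∸ L) + 1) (bd L)) → 0 < n →
      (∀ σ′ → Frame σ′ → σ′ #s₁ ≡ ∑ (z + 1) (bd n) → Halts t 58 σ′) →
      Halts (m * (n * 25 + 23) + (1 + t)) 13 σ
    rows zero L σ L≡n inv σs₁ 0<n cont with trans (sym (+-identityʳ L)) L≡n | inv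
    ... | refl | fr@((_ , σn , _) , _) , _ , σL , _ =
      jump≤-taken refl σn σL ≤-refl $
      cont σ fr (trans (σs₁ 0<n) (cong (λ v → ∑ (v + 1) (bd n)) (trans (cong (z /^_) (n∸n≡0 n)) (n/1≡n z))))
    rows {t} (suc m) L σ L≡n inv _ 0<n cont =
      weaken (≤-reflexive (lemma (n * 25) (m * (n * 25 + 23)) t)) $
      Row.row L (subst (L <_) L≡n (m<m+n L z<s)) σ inv
        λ σ′ inv′ σs₁ → rows m (suc L) σ′ (trans (sym (+-suc L m)) L≡n) inv′ (λ _ → σs₁) 0<n cont
      where
      lemma : ∀ a b t → a + (23 + (b + (1 + t))) ≡ a + 23 + b + (1 + t)
      lemma = solve-∀

  -- The search for the digits

  -- `below` and `above` are all the search knows of ranks: the count of bordered words of value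
  -- less than `X` reaches `r` exactly when `X` passes `T`.
  module Search (0<n : 0 < n) (1<k : 1 < k) (T<k^n : T < k ^ n)
    (below : ∀ {X} → X ≤ T → ∑ X (bd n) < r) (above : ∀ {X} → T < X → r ≤ ∑ X (bd n)) where

    -- The 9 is 6 steps around the table computation in `probe` and 3 in `decide`.
    iteration : ℕ
    iteration = 9 + n * (n * 25 + 23)

    Inv : ℕ → ℕ → State → Set
    Inv x P σ = Constants σ × σ #x ≡ x × σ #P ≡ P

    probe : ∀ {t} x j σ → x + k ^ j ≤ k ^ n → Inv x (k ^ j) σ →
      (∀ σ′ → Inv x (k ^ j) σ′ → σ′ #s₁ ≡ ∑ (x + k ^ j) (bd n) → Halts t 58 σ′) →
      Halts (6 + n * (n * 25 + 23) + t) 8 σ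
    probe {t} x j σ x+P≤k^n ((σr , σn , σk , σ1 , σbase , σN , σ0) , σx , σP) cont =
      weaken (≤-reflexive (lemma (n * (n * 25 + 23)) t)) $
      jump≤-skipped refl σP σ0 (m^n>0 k j) $
      add-step (x + k ^ j) refl σx σP refl $
      sub-step z refl refl σ1 (sym 1+z≡) $
      const-step refl $
      add-step (k ^ n) refl σN σ0 (+-identityʳ (k ^ n)) $
      Count.rows x (k ^ j) z (subst (_≤ k ^ n) (sym 1+z≡) x+P≤k^n) n 0 _ refl
        (((σr , σn , σk , σ1 , σbase , σN , σ0) , σx , σP , refl) , (λ { (suc l) _ (s≤s ()) }) , refl , refl)
        (λ ()) 0<n
        λ σ′ (cs , σx , σP , _) σs₁ → cont σ′ (cs , σx , σP)
          (trans σs₁ (cong (λ v → ∑ v (bd n)) (trans (+-comm z 1) 1+z≡)))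
      where
      z = x + pred (k ^ j)
      1+z≡ : 1 + z ≡ x + k ^ j
      1+z≡ = trans (sym (+-suc x (pred (k ^ j)))) (cong (λ v → x + v) (suc-pred (k ^ j) {{m^n≢0 k j}}))
      lemma : ∀ a t → 5 + (a + (1 + t)) ≡ 6 + a + t
      lemma = solve-∀

    -- Keeps the probed bound within length `n`: `c * k ^ j` is at most `T < k ^ n`, and `k ^ n` is
    -- a multiple of `k ^ j`, so a whole block is left.
    next-block-≤ : ∀ j q c s → j ≤ n → (c + q) * k ^ j + s ≡ T → c * k ^ j + k ^ j ≤ k ^ n
    next-block-≤ j q c s j≤n T≡ = begin
      c * k ^ j + k ^ j        ≡⟨ +-comm (c * k ^ j) (k ^ j) ⟩
      suc c * k ^ j            ≤⟨ *-monoˡ-≤ (k ^ j) c<k^[n-j] ⟩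
      k ^ (n ∸ j) * k ^ j      ≡⟨ k^n≡ ⟨
      k ^ n                    ∎
      where
      open ≤-Reasoning
      k^n≡ : k ^ n ≡ k ^ (n ∸ j) * k ^ j
      k^n≡ = trans (cong (k ^_) (sym (m∸n+n≡m j≤n))) (^-distribˡ-+-* k (n ∸ j) j)
      c<k^[n-j] : c < k ^ (n ∸ j)
      c<k^[n-j] = *-cancelʳ-< (k ^ j) c (k ^ (n ∸ j)) (≤-<-trans
        (≤-trans (*-monoˡ-≤ (k ^ j) (m≤m+n c q)) (m≤m+n _ s))
        (subst₂ _<_ (sym T≡) k^n≡ T<k^n))

    -- With x = c · k ^ j, the quotient q of T − x by k ^ j is what is left of the current digit.
    search : ∀ {t} j q c s σ → j ≤ n → (c + q) * k ^ j + s ≡ T → s < k ^ j → Inv (c * k ^ j) (k ^ j) σ →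
      (∀ σ′ → Constants σ′ → σ′ #x ≡ T → Halts t 63 σ′) →
      Halts ((1 + (q + j * k)) * iteration + (1 + t)) 8 σ

    -- The measure is `q + j * k`. Advancing `x` lowers `q` by one; passing to the next digit frees
    -- `k`, which pays for the new `q < k` and for the probe that will end that digit.
    decide : ∀ {t} j q c s σ → j ≤ n → (c + q) * k ^ j + s ≡ T → s < k ^ j → Inv (c * k ^ j) (k ^ j) σ →
      σ #s₁ ≡ ∑ (c * k ^ j + k ^ j) (bd n) →
      (∀ σ′ → Constants σ′ → σ′ #x ≡ T → Halts t 63 σ′) →
      Halts (3 + ((q + j * k) * iteration + (1 + t))) 58 σ

    search {t} j q c s σ j≤n T≡ s<k^j inv cont =
      weaken (≤-reflexive (lemma (n * (n * 25 + 23)) (q + j * k) t)) $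
      probe (c * k ^ j) j σ (next-block-≤ j q c s j≤n T≡) inv
        λ σ′ inv′ σs₁ → decide j q c s σ′ j≤n T≡ s<k^j inv′ σs₁ cont
      where
      lemma : ∀ a b t → 6 + a + (3 + (b * (9 + a) + (1 + t))) ≡ (1 + b) * (9 + a) + (1 + t)
      lemma = solve-∀

    decide j (suc q) c s σ j≤n T≡ s<k^j (cs@(σr , _) , σx , σP) σs₁ cont =
      jump≤-skipped refl σr σs₁ (below x+P≤T) $
      add-step (suc c * k ^ j) refl σx σP (+-comm (c * k ^ j) (k ^ j)) $
      jump-step refl $
      search j q (suc c) s _ j≤n (trans (cong (λ v → v * k ^ j + s) (sym (+-suc c q))) T≡) s<k^j
        (cs , refl , σP) cont
      where
      x+P≤T : c * k ^ j + k ^ j ≤ T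
      x+P≤T = begin
        c * k ^ j + k ^ j        ≡⟨ +-comm (c * k ^ j) (k ^ j) ⟩
        suc c * k ^ j            ≤⟨ *-monoˡ-≤ (k ^ j) (≤-trans (s≤s (m≤m+n c q)) (≤-reflexive (sym (+-suc c q)))) ⟩
        (c + suc q) * k ^ j      ≤⟨ m≤m+n _ s ⟩
        (c + suc q) * k ^ j + s  ≡⟨ T≡ ⟩
        T                        ∎
        where open ≤-Reasoning
    decide {t} (suc j) zero c s σ j<n T≡ s<k^j (cs@(σr , _ , σk , _) , σx , σP) σs₁ cont =
      jump≤-taken refl σr σs₁ (above T<x+P) $
      quo-step (k ^ j) refl σP σk k≢0 (k^[1+j]/k j) $
      jump-step refl $
      weaken (+-monoˡ-≤ (1 + t) (*-monoˡ-≤ iteration (+-monoˡ-≤ (j * k) q<k))) $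
      search j (s /^ j) (c * k) (s %^ j) _ (<⇒≤ j<n) T≡′ (m%n<n s (k ^ j) {{m^n≢0 k j}})
        (cs , trans σx (sym (*-assoc c k (k ^ j))) , refl) cont
      where
      T<x+P : T < c * k ^ suc j + k ^ suc j
      T<x+P = subst (_< c * k ^ suc j + k ^ suc j)
        (trans (cong (λ v → v * k ^ suc j + s) (sym (+-identityʳ c))) T≡)
        (+-monoʳ-< (c * k ^ suc j) s<k^j)
      q<k : s /^ j < k
      q<k = m<n*o⇒m/o<n {{m^n≢0 k j}} s<k^j
      T≡′ : (c * k + s /^ j) * k ^ j + s %^ j ≡ T
      T≡′ = begin
        (c * k + s /^ j) * k ^ j + s %^ j            ≡⟨ lemma c k (k ^ j) (s /^ j) (s %^ j) ⟩
        (c + 0) * (k * k ^ j) + (s /^ j * k ^ j + s %^ j)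
          ≡⟨ cong (λ v → (c + 0) * (k * k ^ j) + v) (m≡[m/n]*n+m%n s (k ^ j) {{m^n≢0 k j}}) ⟨
        (c + 0) * (k * k ^ j) + s                    ≡⟨ T≡ ⟩
        T                                            ∎
        where
        open ≡-Reasoning
        lemma : ∀ c k p a b → (c * k + a) * p + b ≡ (c + 0) * (k * p) + (a * p + b)
        lemma = solve-∀
    decide zero zero c zero σ j≤n T≡ s<k^j (cs@(σr , _ , σk , _ , _ , _ , σ0) , σx , σP) σs₁ cont =
      jump≤-taken refl σr σs₁ (above (≤-reflexive (trans (+-comm 1 T) (cong (_+ 1) (sym x≡T))))) $
      -- Here `P` is 1, and `1 < k` makes the quotient 0, which ends the outer loop.
      quo-step 0 refl σP σk k≢0 (m<n⇒m/n≡0 1<k) $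
      jump-step refl $
      jump≤-taken refl refl σ0 z≤n $
      cont _ cs (trans σx x≡T)
      where
      x≡T : c * 1 ≡ T
      x≡T = trans (cong (_* 1) (sym (+-identityʳ c))) (trans (sym (+-identityʳ _)) T≡)
    decide zero zero c (suc s) σ j≤n T≡ (s≤s ()) inv σs₁ cont

    -- Writing the output and the complete run

    Digits : ℕ → State → Set
    Digits l σ = ∀ i → l ≤ i → i < n → σ (24 + i) ≡ suc (T /^ (n ∸ suc i) % k)

    output : ∀ l σ → l ≤ n → Constants σ → σ #x ≡ T /^ (n ∸ l) → σ #l ≡ l → Digits l σ →
      Halts (l * 8 + 3) 64 σ
    output zero σ _ (_ , _ , _ , _ , σbase , _ , σ0) σx σl digits =
      jump≤-taken refl σl σ0 z≤n $
      add-step 24 refl σbase σ0 refl $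
      halt-step refl (refl , λ i → digits i z≤n)
    output (suc l) σ l<n (σr , σn , σk , σ1 , σbase , σN , σ0) σx σl digits =
      jump≤-skipped refl σl σ0 z<s $
      sub-step l refl σl σ1 refl $
      rem-step (X % k) refl σx σk k≢0 refl $
      add-step (suc (X % k)) refl refl σ1 (+-comm (X % k) 1) $
      quo-step (T /^ (n ∸ l)) refl σx σk k≢0 X/k≡ $
      add-step (24 + l) refl refl σbase (+-comm l 24) $
      store-step (24 + l) (suc (X % k)) refl refl (+-mono-≤ (m≤m+n 25 3) (≤-trans (<⇒≤ l<n) (m≤m+n n n))) refl $
      jump-step refl $
      output l _ (<⇒≤ l<n) (σr , σn , σk , σ1 , σbase , σN , σ0) refl refl digits′
      where
      X = T /^ (n ∸ suc l)
      X/k≡ : X / k ≡ T /^ (n ∸ l)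
      X/k≡ = begin
        X / k                        ≡⟨ /-congʳ {{k≢0}} {{m^n≢0 k 1}} (sym (*-identityʳ k)) ⟩
        X /^ 1                       ≡⟨ /^-/^ T (n ∸ suc l) 1 ⟩
        T /^ (n ∸ suc l + 1)         ≡⟨ cong (T /^_) (trans (+-comm (n ∸ suc l) 1) (sym (∸-suc l<n))) ⟩
        T /^ (n ∸ l)                 ∎
        where open ≡-Reasoning
      digits′ : Digits l (σ [ 24 + l ≔ suc (X % k) ])
      digits′ i l≤i i<n with l ≟ i
      ... | yes refl = ≔-same σ (24 + l) (suc (X % k))
      ... | no l≢i   = trans (≔-other σ (suc (X % k)) (l≢i ∘ +-cancelˡ-≡ 24 _ _)) (digits i (≤∧≢⇒< l≤i l≢i) i<n)

    powers : ∀ {t} m i σ → i + m ≡ n → σ #n ≡ n → σ #k ≡ k → σ #1 ≡ 1 → σ #L ≡ i → σ #N ≡ k ^ i →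
      σ #r ≡ r → σ #base ≡ 24 → σ #0 ≡ 0 → σ #x ≡ 0 →
      (∀ σ′ → Constants σ′ → σ′ #x ≡ 0 → Halts t 7 σ′) → Halts (m * 4 + (1 + t)) 3 σ
    powers zero i σ i≡n σn σk σ1 σL σN σr σbase σ0 σx cont with trans (sym (+-identityʳ i)) i≡n
    ... | refl = jump≤-taken refl σn σL ≤-refl $ cont σ (σr , σn , σk , σ1 , σbase , σN , σ0) σx
    powers (suc m) i σ i≡n σn σk σ1 σL σN σr σbase σ0 σx cont =
      jump≤-skipped refl σn σL (subst (i <_) i≡n (m<m+n i z<s)) $
      mul-step (k ^ suc i) refl σN σk (*-comm (k ^ i) k) $
      add-step (suc i) refl σL σ1 (+-comm i 1) $
      jump-step refl $
      powers m (suc i) _ (trans (sym (+-suc i m)) i≡n) σn σk σ1 refl refl σr σbase σ0 σx cont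

    initial : State
    initial 0 = r
    initial 1 = n
    initial 2 = k
    initial _ = 0

    runtime : ℕ
    runtime = 3 + (n * 4 + (1 + (1 + ((1 + n * k) * iteration + (1 + (1 + (n * 8 + 3)))))))

    run : Halts runtime 0 initial
    run =
      const-step refl $
      const-step refl $
      const-step refl $
      powers n 0 _ refl refl refl refl refl refl refl refl refl refl
        λ σ (cs@(_ , _ , _ , _ , _ , σN , σ0)) σx →
      add-step (k ^ n) refl σN σ0 (+-identityʳ (k ^ n)) $
      search n 0 0 T _ ≤-refl refl T<k^n (cs , σx , refl)
        λ σ (cs@(_ , σn , _ , _ , _ , _ , σ0)) σx →
      add-step n refl σn σ0 (+-identityʳ n) $
      output n _ ≤-refl cs (trans σx (sym (trans (cong (T /^_) (n∸n≡0 n)) (n/1≡n T)))) refl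
        λ i n≤i i<n → contradiction i<n (≤⇒≯ n≤i)

-- Words and their base-k values

module Values (k : ℕ) .{{_ : NonZero k}} where

  open Borders k

  val : Word k → ℕ
  val []      = 0
  val (a ∷ w) = toℕ a * k ^ length w + val w

  val-< : ∀ w → val w < k ^ length w
  val-< []      = z<s
  val-< (a ∷ w) = begin-strict
    toℕ a * k ^ length w + val w          <⟨ +-monoʳ-< (toℕ a * k ^ length w) (val-< w) ⟩
    toℕ a * k ^ length w + k ^ length w   ≡⟨ +-comm _ (k ^ length w) ⟩
    suc (toℕ a) * k ^ length w            ≤⟨ *-monoˡ-≤ (k ^ length w) (toℕ<n a) ⟩
    k ^ suc (length w)                    ∎
    where open ≤-Reasoning

  val-/^ : ∀ a w → val (a ∷ w) /^ length w ≡ toℕ a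
  val-/^ a w = [q*d+s]/d≡q (toℕ a) (k ^ length w) {{m^n≢0 k (length w)}} (val-< w)

  val-%^ : ∀ a w → val (a ∷ w) %^ length w ≡ val w
  val-%^ a w = [q*d+s]%d≡s (toℕ a) (k ^ length w) {{m^n≢0 k (length w)}} (val-< w)

  val-injective : ∀ u v → length u ≡ length v → val u ≡ val v → u ≡ v
  val-injective []      []      _   _  = refl
  val-injective (a ∷ u) (b ∷ v) |≡| eq = cong₂ _∷_
    (toℕ-injective (trans (sym (val-/^ a u)) (trans (cong₂ _/^_ eq |u|≡|v|) (val-/^ b v))))
    (val-injective u v |u|≡|v|
      (trans (sym (val-%^ a u)) (trans (cong₂ _%^_ eq |u|≡|v|) (val-%^ b v))))
    where |u|≡|v| = suc-injective |≡|

  val-++ : ∀ u v → val (u ++ v) ≡ val u * k ^ length v + val v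
  val-++ []      v = refl
  val-++ (a ∷ u) v = begin
    toℕ a * k ^ length (u ++ v) + val (u ++ v)
      ≡⟨ cong₂ (λ x y → toℕ a * x + y)
           (trans (cong (k ^_) (length-++ u)) (^-distribˡ-+-* k (length u) (length v)))
           (val-++ u v) ⟩
    toℕ a * (k ^ length u * k ^ length v) + (val u * k ^ length v + val v)
      ≡⟨ lemma (toℕ a) (k ^ length u) (k ^ length v) (val u) (val v) ⟩
    (toℕ a * k ^ length u + val u) * k ^ length v + val v ∎
    where
    open ≡-Reasoning
    lemma : ∀ a p q x y → a * (p * q) + (x * q + y) ≡ (a * p + x) * q + y
    lemma = solve-∀

  val-prefix : ∀ u v → val (u ++ v) /^ length v ≡ val u
  val-prefix u v = trans (cong (_/^ length v) (val-++ u v))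
    ([q*d+s]/d≡q (val u) (k ^ length v) {{m^n≢0 k (length v)}} (val-< v))

  val-suffix : ∀ u v → val (u ++ v) %^ length v ≡ val v
  val-suffix u v = trans (cong (_%^ length v) (val-++ u v))
    ([q*d+s]%d≡s (val u) (k ^ length v) {{m^n≢0 k (length v)}} (val-< v))

  suffix⇒++ : ∀ {u w : Word k} → Suffix _≡_ u w → ∃[ v ] v ++ u ≡ w
  suffix⇒++ s with Suffix.toView s
  ... | v Suffix.++ eq = v , cong (v ++_) (Pointwise-≡⇒≡ eq)

  prefix⇒++ : ∀ {u w : Word k} → Prefix _≡_ u w → ∃[ v ] u ++ v ≡ w
  prefix⇒++ p with Prefix.toView p
  ... | eq Prefix.++ v = v , cong (_++ v) (Pointwise-≡⇒≡ eq)

  bordered⇒hasBorder : ∀ {w} → Bordered w → HasBorder (length w) (val w)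
  bordered⇒hasBorder {w} (u , mkBorder u≢[] u≢w p s) with prefix⇒++ p | suffix⇒++ s
  ... | v , refl | v′ , v′u≡w = subst (λ x → HasBorder x (val w)) (sym (length-++ u))
    (mkHasBorder (0<length u u≢[]) (0<length v v≢[])
      (trans (val-prefix u v) (sym (trans (cong (λ x → val x %^ length u) (sym v′u≡w)) (val-suffix v′ u)))))
    where
    0<length : ∀ (x : Word k) → x ≢ [] → 0 < length x
    0<length []      x≢[] = contradiction refl x≢[]
    0<length (_ ∷ _) _    = z<s
    v≢[] : v ≢ []
    v≢[] refl = u≢w (sym (++-identityʳ u))

  -- The prefix and the suffix of length `l` agree in length and value, so `val-injective` makes
  -- them one word.
  hasBorder⇒bordered : ∀ {w} → HasBorder (length w) (val w) → Bordered w
  hasBorder⇒bordered {w} (l , l<n , 0<l , b) = u , mkBorder u≢[] u≢w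
    (subst (Prefix _≡_ u) (take++drop≡id l w) (Prefix.fromView (≡⇒Pointwise-≡ refl Prefix.++ drop l w)))
    (subst₂ (Suffix _≡_) (sym u≡v) (take++drop≡id (length w ∸ l) w)
      (take (length w ∸ l) w Suffix.++ˢ Suffix.here (≡⇒Pointwise-≡ refl)))
    where
    u v : Word k
    u = take l w
    v = drop (length w ∸ l) w
    |u| : length u ≡ l
    |u| = trans (length-take l w) (m≤n⇒m⊓n≡m (<⇒≤ l<n))
    |v| : length v ≡ l
    |v| = trans (length-drop (length w ∸ l) w) (m∸[m∸n]≡n (<⇒≤ l<n))
    u≡v : u ≡ v
    u≡v = val-injective u v (trans |u| (sym |v|)) (begin
      val u                                  ≡⟨ val-prefix u (drop l w) ⟨
      val (u ++ drop l w) /^ length (drop l w)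
        ≡⟨ cong₂ (λ x y → val x /^ y) (take++drop≡id l w) (length-drop l w) ⟩
      val w /^ (length w ∸ l)                ≡⟨ b ⟩
      val w %^ l                             ≡⟨ cong₂ (λ x y → val x %^ y) (take++drop≡id (length w ∸ l) w) |v| ⟨
      val (take (length w ∸ l) w ++ v) %^ length v ≡⟨ val-suffix (take (length w ∸ l) w) v ⟩
      val v                                  ∎)
      where open ≡-Reasoning
    u≢[] : u ≢ []
    u≢[] u≡[] = <⇒≢ 0<l (trans (sym (cong length u≡[])) |u|)
    u≢w : u ≢ w
    u≢w u≡w = <⇒≢ l<n (trans (sym |u|) (cong length u≡w))

  val-digit : ∀ w (i : Fin (length w)) → val w /^ (length w ∸ suc (toℕ i)) % k ≡ toℕ (lookup w i)
  val-digit (a ∷ w) Fin.zero    = trans (cong (_% k) (val-/^ a w)) (m<n⇒m%n≡m (toℕ<n a))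
  val-digit (a ∷ w) (Fin.suc i) = begin
    (toℕ a * k ^ length w + val w) /^ e % k
      ≡⟨ cong (λ x → (toℕ a * x + val w) /^ e % k) k^|w|≡ ⟩
    (toℕ a * (k ^ i′ * k * k ^ e) + val w) /^ e % k
      ≡⟨ cong (λ x → (x + val w) /^ e % k) (lemma (toℕ a) (k ^ i′) k (k ^ e)) ⟩
    (toℕ a * k ^ i′ * k * k ^ e + val w) /^ e % k
      ≡⟨ cong (_% k) (+-distrib-/-∣ˡ (val w) {{m^n≢0 k e}} (divides-refl (toℕ a * k ^ i′ * k))) ⟩
    ((toℕ a * k ^ i′ * k * k ^ e) /^ e + val w /^ e) % k
      ≡⟨ cong (λ x → (x + val w /^ e) % k) (m*n/n≡m (toℕ a * k ^ i′ * k) (k ^ e) {{m^n≢0 k e}}) ⟩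
    (toℕ a * k ^ i′ * k + val w /^ e) % k
      ≡⟨ %-remove-+ˡ (val w /^ e) (divides-refl (toℕ a * k ^ i′)) ⟩
    val w /^ e % k
      ≡⟨ val-digit w i ⟩
    toℕ (lookup w i) ∎
    where
    open ≡-Reasoning
    i′ = toℕ i
    e = length w ∸ suc i′
    -- The weight of the leading letter retains a factor `k` after division by `k ^ e`, so it
    -- vanishes modulo `k`.
    k^|w|≡ : k ^ length w ≡ k ^ i′ * k * k ^ e
    k^|w|≡ = trans (cong (k ^_) (sym (m+[n∸m]≡n (toℕ<n i))))
      (trans (^-distribˡ-+-* k (suc i′) e) (cong (_* k ^ e) (*-comm k (k ^ i′))))
    lemma : ∀ a p k q → a * (p * k * q) ≡ a * p * k * q
    lemma = solve-∀

  -- Ranks as counts of values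

  -- The values run through `a`, ..., `b ∸ 1` in order; this lets a position in a filtered listing
  -- be read off as a sum over values.
  data Consecutive (a : ℕ) : List (Word k) → ℕ → Set where
    []  : Consecutive a [] a
    _∷_ : ∀ {w ws b} → val w ≡ a → Consecutive (suc a) ws b → Consecutive a (w ∷ ws) b

  consecutive-++ : ∀ {a b c us vs} → Consecutive a us b → Consecutive b vs c → Consecutive a (us ++ vs) c
  consecutive-++ []         cs′ = cs′
  consecutive-++ (eq ∷ cs) cs′ = eq ∷ consecutive-++ cs cs′

  consecutive-map-∷ : ∀ c {n a b ws} → All (λ w → length w ≡ n) ws → Consecutive a ws b →
    Consecutive (toℕ c * k ^ n + a) (map (c ∷_) ws) (toℕ c * k ^ n + b)
  consecutive-map-∷ c []           []         = []
  consecutive-map-∷ c {n} {a} {b} {_ ∷ ws} (refl ∷ ls) (refl ∷ cs) = refl ∷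
    subst (λ x → Consecutive x (map (c ∷_) ws) (toℕ c * k ^ n + b)) (+-suc (toℕ c * k ^ n) a)
      (consecutive-map-∷ c ls cs)

  consecutive-words : ∀ n → Consecutive 0 (words k n) (k ^ n)
  consecutive-words zero    = refl ∷ []
  consecutive-words (suc n) = blocks k 0 id (λ _ → refl)
    where
    -- Generalises `allFin k` to its tails: `g` enumerates the last `j` letters, starting with value
    -- `a`.
    blocks : ∀ j a (g : Fin j → Fin k) → (∀ i → toℕ (g i) ≡ a + toℕ i) →
      Consecutive (a * k ^ n) (concat (map (λ c → map (c ∷_) (words k n)) (tabulate g))) ((a + j) * k ^ n)
    blocks zero    a g eq = subst (Consecutive (a * k ^ n) []) (cong (_* k ^ n) (sym (+-identityʳ a))) []
    blocks (suc j) a g eq = consecutive-++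
      (subst₂ (λ x y → Consecutive x (map (g Fin.zero ∷_) (words k n)) y)
        (trans (+-identityʳ _) (cong (_* k ^ n) g0≡a))
        (trans (cong (λ x → x * k ^ n + k ^ n) g0≡a) (+-comm (a * k ^ n) (k ^ n)))
        (consecutive-map-∷ (g Fin.zero) (All.tabulate (words-sound k n)) (consecutive-words n)))
      (subst (λ x → Consecutive (suc a * k ^ n)
                      (concat (map (λ c → map (c ∷_) (words k n)) (tabulate (g ∘ Fin.suc)))) (x * k ^ n))
        (sym (+-suc a j))
        (blocks j (suc a) (g ∘ Fin.suc) (λ i → trans (eq (Fin.suc i)) (+-suc a (toℕ i)))))
      where
      g0≡a : toℕ (g Fin.zero) ≡ a
      g0≡a = trans (eq Fin.zero) (+-identityʳ a)

  -- Relative to a start `a`, so that the induction along the listing can move the start.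
  Position : (ℕ → ℕ) → ℕ → Word k → ℕ → Set
  Position f a w i = ∃[ d ] val w ≡ a + d × ∑ d (λ j → f (a + j)) ≡ i × f (a + d) ≡ 1

  position-suc : ∀ f w {a i x} → x ≡ f a → Position f (suc a) w i → Position f a w (x + i)
  position-suc f w {a} refl (d , v≡ , ∑≡ , f≡) = suc d , trans v≡ (sym (+-suc a d)) ,
    trans (∑-front d (λ j → f (a + j)))
      (cong₂ _+_ (cong f (+-identityʳ a)) (trans (∑-cong d (λ j _ → cong f (+-suc a j))) ∑≡)) ,
    trans (cong f (+-suc a d)) f≡

  filter-position : ∀ {P : Word k → Set} (P? : Decidable P) (f : ℕ → ℕ) {a b ws} → Consecutive a ws b →
    All (λ w → 𝟙 (P? w) ≡ f (val w)) ws →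
    (i : Fin (length (filter P? ws))) → Position f a (lookup (filter P? ws) i) (toℕ i)
  filter-position P? f {ws = w ∷ ws} (refl ∷ cs) (fw ∷ fws) i with P? w
  ... | no _ = position-suc f (lookup (filter P? ws) i) fw (filter-position P? f cs fws i)
  filter-position P? f {ws = w ∷ ws} (refl ∷ cs) (fw ∷ fws) Fin.zero | yes _ =
    0 , sym (+-identityʳ (val w)) , refl , trans (cong f (+-identityʳ (val w))) (sym fw)
  filter-position P? f {ws = w ∷ ws} (refl ∷ cs) (fw ∷ fws) (Fin.suc i) | yes _ =
    position-suc f (lookup (filter P? ws) i) fw (filter-position P? f cs fws i)

  bordered-position : ∀ n (i : Fin (numBordered k n)) → let T = val (lookup (borderedWords k n) i) in
    ∑ T (bd n) ≡ toℕ i × bd n T ≡ 1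
  bordered-position n i with filter-position bordered? (bd n) (consecutive-words n)
    (All.tabulate (λ {w} w∈ → indicator w (words-sound k n w∈))) i
    where
    indicator : ∀ w → length w ≡ n → 𝟙 (bordered? w) ≡ bd n (val w)
    indicator w refl = 𝟙-cong (bordered? w) (hasBorder? (length w) (val w))
      bordered⇒hasBorder hasBorder⇒bordered
  ... | d , refl , ∑≡ , bd≡ = ∑≡ , bd≡

-- The time bound

-- The run is of order `n ^ 3 * k`; as `1 ≤ n` and `1 ≤ ⌊log₂ k ⌋`, every term is below `W`. The
-- constant is 12 + 10 for the linear part plus 2 · (25 + 23 + 9) for the search.
runtime-≤ : ∀ n k → 1 ≤ n → 2 ≤ k →
  3 + (n * 4 + (1 + (1 + ((1 + n * k) * (9 + n * (n * 25 + 23)) + (1 + (1 + (n * 8 + 3)))))))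
    ≤ 136 * (n ^ 4 * k * ⌊log₂ k ⌋)
runtime-≤ n k 1≤n 2≤k = begin
  3 + (n * 4 + (1 + (1 + ((1 + n * k) * (9 + n * (n * 25 + 23)) + (1 + (1 + (n * 8 + 3)))))))
    ≡⟨ regroup n k ⟩
  n * 12 + 10 + (1 + n * k) * (n * n * 25 + n * 23 + 9)
    ≤⟨ +-mono-≤ (+-mono-≤ (*-monoˡ-≤ 12 n≤W) (*-monoˡ-≤ 10 1≤W))
                (*-mono-≤ (+-monoˡ-≤ (n * k) 1≤nk)
                          (+-mono-≤ (+-monoʳ-≤ (n * n * 25) (*-monoˡ-≤ 23 n≤n²)) (*-monoˡ-≤ 9 1≤n²))) ⟩
  W * 12 + W * 10 + (n * k + n * k) * (n * n * 25 + n * n * 23 + n * n * 9)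
    ≡⟨ collect n k W ⟩
  W * 22 + n * n * n * k * 114
    ≤⟨ +-monoʳ-≤ (W * 22) (*-monoˡ-≤ 114 n³k≤W) ⟩
  W * 22 + W * 114
    ≡⟨ final W ⟩
  136 * W ∎
  where
  open ≤-Reasoning
  W = n ^ 4 * k * ⌊log₂ k ⌋
  1≤k : 1 ≤ k
  1≤k = ≤-trans (n≤1+n 1) 2≤k
  1≤nk : 1 ≤ n * k
  1≤nk = *-mono-≤ 1≤n 1≤k
  n≤n² : n ≤ n * n
  n≤n² = subst (_≤ n * n) (*-identityʳ n) (*-monoʳ-≤ n 1≤n)
  1≤n² : 1 ≤ n * n
  1≤n² = *-mono-≤ 1≤n 1≤n
  n³k≤W : n * n * n * k ≤ W
  n³k≤W = begin
    n * n * n * k                 ≡⟨ unit n k ⟩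
    1 * (n * n * n) * k * 1       ≤⟨ *-mono-≤ (*-monoˡ-≤ k (*-monoˡ-≤ (n * n * n) 1≤n)) (⌊log₂⌋-mono-≤ 2≤k) ⟩
    n * (n * n * n) * k * ⌊log₂ k ⌋ ≡⟨ cong (λ x → x * k * ⌊log₂ k ⌋) (fourth n) ⟩
    W                             ∎
    where
    unit : ∀ n k → n * n * n * k ≡ 1 * (n * n * n) * k * 1
    unit = solve-∀
    fourth : ∀ n → n * (n * n * n) ≡ n * (n * (n * (n * 1)))
    fourth = solve-∀
  n≤W : n ≤ W
  n≤W = ≤-trans (≤-trans (≤-reflexive (unit n)) (*-mono-≤ (*-mono-≤ (*-monoˡ-≤ n 1≤n) 1≤n) 1≤k)) n³k≤W
    where
    unit : ∀ n → n ≡ 1 * n * 1 * 1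
    unit = solve-∀
  1≤W : 1 ≤ W
  1≤W = ≤-trans 1≤n n≤W
  regroup : ∀ n k → 3 + (n * 4 + (1 + (1 + ((1 + n * k) * (9 + n * (n * 25 + 23)) + (1 + (1 + (n * 8 + 3)))))))
    ≡ n * 12 + 10 + (1 + n * k) * (n * n * 25 + n * 23 + 9)
  regroup = solve-∀
  collect : ∀ n k w → w * 12 + w * 10 + (n * k + n * k) * (n * n * 25 + n * n * 23 + n * n * 9)
    ≡ w * 22 + n * n * n * k * 114
  collect = solve-∀
  final : ∀ w → w * 22 + w * 114 ≡ 136 * w
  final = solve-∀

-- Joining rank, output and resource bounds

theorem11 : ∃[ P ] ∃[ C ] ∃[ D ] ∀ (n k r : ℕ) → 1 ≤ n → 2 ≤ k → 1 ≤ r → r ≤ numBordered k n →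
    ∃[ w ] HasBorderedRank k n w r ×
    (∃[ m ] Outputs m w ×
    (Σ[ ρ ∈ HaltingRun P ⟨ 0 , input r n k ⟩ m ]
    (time ρ ≤ C * (n ^ 4 * k * ⌊log₂ k ⌋) × space ρ ≤ D * n)))
theorem11 = program , 136 , 30 , prove
  where
  prove : ∀ (n k r : ℕ) → 1 ≤ n → 2 ≤ k → 1 ≤ r → r ≤ numBordered k n →
    ∃[ w ] HasBorderedRank k n w r ×
    (∃[ m ] Outputs m w ×
    (Σ[ ρ ∈ HaltingRun program ⟨ 0 , input r n k ⟩ m ]
    (time ρ ≤ 136 * (n ^ 4 * k * ⌊log₂ k ⌋) × space ρ ≤ 30 * n)))
  prove n k@(suc _) (suc r) 1≤n 2≤k _ r<N =
    let m , (σ , m≈σ , out) , ρ , ρ≤ , ρ<B = run (input (suc r) n k) start in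
    w , (i , cong suc i≡r , refl) ,
    m , (24 , trans (m≈σ 0) (cong +_ (proj₁ out)) , letters m≈σ out) ,
    ρ , ≤-trans ρ≤ (runtime-≤ n k 1≤n 2≤k) ,
    ≤-trans (space-≤ ρ ρ<B) (≤-trans (+-monoˡ-≤ (n + n) (*-monoʳ-≤ 28 1≤n)) (≤-reflexive (collect n)))
    where
    open Values k
    open Borders k
    i : Fin (numBordered k n)
    i = fromℕ< r<N
    w : Word k
    w = lookup (borderedWords k n) i
    T = val w
    |w| : length w ≡ n
    |w| = proj₁ (LexListing.sound (borderedListing k n) (∈-lookup i))
    i≡r : toℕ i ≡ r
    i≡r = toℕ-fromℕ< r<N
    position = bordered-position n i
    -- Positions start at 0, so `r` bordered words lie below `T`, and `T` itself brings the count to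
    -- `suc r`.
    below : ∀ {X} → X ≤ T → ∑ X (bd n) < suc r
    below X≤T = s≤s (≤-trans (∑-mono-≤ (bd n) X≤T) (≤-reflexive (trans (proj₁ position) i≡r)))
    above : ∀ {X} → T < X → suc r ≤ ∑ X (bd n)
    above T<X = ≤-trans
      (≤-reflexive (sym (trans (cong₂ _+_ (trans (proj₁ position) i≡r) (proj₂ position)) (+-comm r 1))))
      (∑-mono-≤ (bd n) T<X)
    open Correctness n k (suc r) T using (module Search; Output)
    open Search 1≤n 2≤k (subst (λ x → T < k ^ x) |w| (val-< w)) below above
    start : input (suc r) n k ≈ initial
    start 0 = refl
    start 1 = refl
    start 2 = refl
    start (suc (suc (suc _))) = refl
    letters : ∀ {m σ} → m ≈ σ → Output σ → ∀ (j : Fin (length w)) → m (24 + toℕ j) ≡ + letter (lookup w j)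
    letters m≈σ (_ , digits) j = trans (m≈σ (24 + toℕ j)) (cong +_
      (trans (digits (toℕ j) (subst (toℕ j <_) |w| (toℕ<n j)))
      (cong suc (trans (cong (λ x → T /^ (x ∸ suc (toℕ j)) % k) (sym |w|)) (val-digit w j)))))
    collect : ∀ n → 28 * n + (n + n) ≡ 30 * n
    collect = solve-∀
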